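{- Let $G$ be a finite abelian group (written additively) of order $|G|$, and let $D\subseteq G$ be a subset with $|D|=|G|-c\geq c$. Let $b\in G$ and let $k$ be an integer with $0\le k\le |D|$. Let $N(D,k,b)$ be the number of $k$-element subsets $S\subseteq D$ such that $\sum_{x\in S}x=b$. Then $$\left| N(D, k, b)-\frac{1}{|G|}\binom{|G|-c}{k}\right|\leq \binom{c + (|G|-2c)\left(\sum_{i\mid e(G),\ \mu(i)=-1}\frac {1}{i}\right)+k-1}{k},$$ where $e(G)$ is the exponent of $G$ (the maximal order of an element of $G$).
   Context: For a real number $x$ and an integer $k\ge 0$, $\binom{x}{k}=\frac{(x)_k}{k!}$ with $(x)_0=1$ and $(x)_k=x(x-1)\cdots(x-k+1)$ for $k\geq 1$. $\mu$ is the Möbius function, and the sum $\sum_{i\mid e(G),\,\mu(i)=-1}\frac1i$ runs over the positive divisors $i$ of $e(G)$ with $\mu(i)=-1$. -}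

module Defs where

open import Algebra.Bundles using (AbelianGroup)
import Algebra.Definitions.RawMonoid as RawMonoidDefs
open import Data.Bool using (if_then_else_)
open import Data.Fin using (Fin)
import Data.Fin.Properties as Fin
open import Data.Fin.Subset using (Subset; inside; outside; ∣_∣)
open import Data.Fin.Subset.Properties using (_⊆?_)
open import Data.Integer as ℤ using (ℤ; 0ℤ; -1ℤ; +_)
open import Data.List using (List; []; _∷_; [_]; _++_; map; filter; foldr; length; upTo)
open import Data.List.Relation.Unary.Unique.DecPropositional using (unique?)
open import Data.Nat as ℕ using (ℕ; zero; suc; NonZero; _≤_; _<_; _!)
open import Data.Nat.Divisibility using (_∣?_)
import Data.Nat.Properties as ℕ
open import Data.Nat.Primality.Factorisation using (factors; factorise)
open import Data.Product using (_×_; ∃-syntax)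
open import Data.Rational as ℚ using (ℚ; 0ℚ; 1ℚ; _/_)
open import Data.Vec using ([]; _∷_; lookup)
open import Function.Bundles using (Inverse)
open import Function.Properties.Inverse using (Inverse⇒Injection)
open import Level as Level using (Level; _⊔_)
open import Relation.Binary.Definitions using (Decidable)
open import Relation.Binary.PropositionalEquality using (_≡_; setoid)
open import Relation.Nullary.Decidable using (does; via-injection; _×-dec_)

-- All arguments of the generalised binomial coefficient that occur are
-- rational, so ℚ replaces ℝ here.

fromℕ : ℕ → ℚ
fromℕ n = + n / 1

fallingFactorial : ℚ → ℕ → ℚ
fallingFactorial x zero    = 1ℚ
fallingFactorial x (suc k) = fallingFactorial x k ℚ.* (x ℚ.- fromℕ k)

binom : ℚ → ℕ → ℚ
binom x k = fallingFactorial x k ℚ.* (+ 1 / (k !))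
  where instance _ = k ℕ.!≢0

μ : (n : ℕ) .{{_ : NonZero n}} → ℤ
μ n = if does (unique? ℕ._≟_ ps) then -1ℤ ℤ.^ length ps else 0ℤ
  where ps = factors (factorise n)

-- ∑ 1/i over the positive divisors i of e with μ(i) = -1 (where e > 0).
-- The list holds j = i - 1, so that the denominator suc j is visibly nonzero.

negMöbiusSum : ℕ → ℚ
negMöbiusSum e = foldr ℚ._+_ 0ℚ (map (λ j → + 1 / suc j) indices)
  where
  indices : List ℕ
  indices = filter (λ j → (suc j ∣? e) ×-dec (μ (suc j) ℤ.≟ -1ℤ)) (upTo e)

-- Every subset of Fin n, each listed exactly once.

allSubsets : (n : ℕ) → List (Subset n)
allSubsets zero    = [ [] ]
allSubsets (suc n) = map (outside ∷_) (allSubsets n) ++ map (inside ∷_) (allSubsets n)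

-- The enumeration is a bijection between the elements up to _≈_ and
-- Fin order, so that subsets of the group are values of Subset order.

record FiniteAbelianGroup (a ℓ : Level) : Set (Level.suc (a ⊔ ℓ)) where
  field
    abelianGroup : AbelianGroup a ℓ
    order        : ℕ

  open AbelianGroup abelianGroup public using (Carrier)
  open AbelianGroup abelianGroup using (_≈_; rawMonoid)
    renaming (ε to 0#; setoid to ≈-setoid)

  field
    enumeration : Inverse ≈-setoid (setoid (Fin order))

  open RawMonoidDefs rawMonoid using (sum) renaming (_×_ to _·_)

  index : Carrier → Fin order
  index = Inverse.to enumeration

  element : Fin order → Carrier
  element = Inverse.from enumeration

  instance
    order-nonZero : NonZero order
    order-nonZero = Fin.nonZeroIndex (index 0#)

  _≈?_ : Decidable _≈_
  _≈?_ = via-injection (Inverse⇒Injection enumeration) Fin._≟_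

  subsetSum : Subset order → Carrier
  subsetSum S = sum (λ i → if lookup S i then element i else 0#)

  N : Subset order → ℕ → Carrier → ℕ
  N D k b = length (filter (λ S → (S ⊆? D) ×-dec (∣ S ∣ ℕ.≟ k) ×-dec (subsetSum S ≈? b))
                           (allSubsets order))

  HasOrder : Carrier → ℕ → Set ℓ
  HasOrder x m = 0 < m × m · x ≈ 0# × (∀ j → 0 < j → j · x ≈ 0# → m ≤ j)

  IsExponent : ℕ → Set (a ⊔ ℓ)
  IsExponent e = (∃[ x ] HasOrder x e) × (∀ x m → HasOrder x m → m ≤ e)

{-# OPTIONS --safe #-}
module Submission where

-- Write g k b for the deviation of N D k b from its mean over b. Newton's identities in the group
-- ring give k g_k(b) = ∑_{i=1}^{k} (-1)^{i-1} ∑_{y ∈ D} g_{k-i}(b - i y). No characters are needed: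
-- if i is coprime to the exponent, then y ↦ i y permutes G, and because g_{k-i} has total 0 the inner
-- sum equals minus the sum over the c elements outside D; otherwise it has ∣D∣ = c + M terms, where
-- M = ∣G∣ - 2c, and i is a multiple of a divisor q of e with μ(q) = -1 (any common prime factor).
-- As at most K/q of the numbers 1, …, K are multiples of q, Abel summation shows inductively that
-- ∣g_k∣ ≤ Y_k, where Y_k = binom(z + k - 1, k) is nondecreasing (if z ≥ 1) and satisfies
-- k Y_k = z (Y_0 + … + Y_{k-1}), for z = c + M ∑ 1/q.

open import Defs
open import Algebra.Bundles using (AbelianGroup; CommutativeRing)
import Algebra.Definitions.RawMonoid as RawMonoidDefs
import Algebra.Properties.AbelianGroup as AbelianGroupProperties
import Algebra.Properties.CommutativeMonoid.Mult as Mult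
import Algebra.Properties.Group as GroupProperties
open import Data.Bool using (Bool; if_then_else_; true; false)
open import Data.Fin as Fin using (Fin; zero; suc; toℕ; punchOut)
open import Data.Fin.Permutation using (permutation)
import Data.Fin.Properties as Fin
open import Data.Fin.Subset using (Subset; ∣_∣; inside; outside; ∁; _⊆_)
open import Data.Fin.Subset.Properties using (_⊆?_; ∣∁p∣≡n∸∣p∣; drop-∷-⊆; out⊆; in⊆in)
open import Data.Integer as ℤ using (+_; -1ℤ)
import Data.Integer.Properties as ℤ
open import Data.List using (List; []; _∷_; [_]; foldr; map; filter; upTo; length)
open import Data.List.Membership.Propositional using (_∈_)
open import Data.List.Membership.Propositional.Properties using (∈-filter⁺; ∈-upTo⁺)
open import Data.List.Properties using (filter-++; length-++)
open import Data.List.Relation.Binary.Permutation.Propositional.Properties using (↭-singleton-inv)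
open import Data.List.Relation.Unary.All using (All; []; _∷_)
open import Data.List.Relation.Unary.Any using (here; there)
open import Data.List.Relation.Unary.Unique.DecPropositional using (unique?)
open import Data.Nat as ℕ using (ℕ; zero; suc; NonZero; _!; _<_; _%_)
open import Data.Nat.Coprimality using (Coprime; coprime?; coprime-Bézout; coprime-divisor; gcd≡1⇒coprime)
  renaming (sym to coprime-sym)
open import Data.Nat.Divisibility using (_∣_; _∣?_; divides; ∣m+n∣m⇒∣n; ∣⇒≤; n∣m*n; ∣-trans; m%n≡0⇒n∣m)
open import Data.Nat.DivMod using (m%n<n; m≡m%n+[m/n]*n)
open import Data.Nat.GCD using (gcd; gcd[m,n]∣m; gcd[m,n]∣n; gcd[m,n]≡0⇒n≡0; module Bézout)
open import Data.Nat.Induction using (<-rec)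
open import Data.Nat.ListAction using (product)
open import Data.Nat.Primality using (Prime; prime⇒nonZero)
open import Data.Nat.Primality.Factorisation
  using (factors; factorise; factorisationUnique; primeFactorisation[p]; PrimeFactorisation)
import Data.Nat.Properties as ℕ
open import Data.Product using (_×_; _,_; ∃-syntax; ∃₂; proj₁; proj₂)
open import Data.Rational as ℚ using (ℚ; 0ℚ; 1ℚ; _/_; _+_; _*_; _-_; -_; _≤_; toℚᵘ)
import Data.Rational.Properties as ℚ
open import Data.Rational.Solver using (module +-*-Solver)
open import Data.Rational.Unnormalised as ℚᵘ using (mkℚᵘ; *≡*)
import Data.Rational.Unnormalised.Properties as ℚᵘ
open import Data.Vec using ([]; _∷_; lookup; here)
open import Function using (_∘_)
open import Function.Bundles using (Inverse; _⇔_; mk⇔)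
open import Function.Definitions using (Injective)
open import Level using (Level)
open import Relation.Binary.PropositionalEquality
  using (_≡_; _≢_; refl; sym; trans; cong; cong₂; subst; module ≡-Reasoning)
import Relation.Binary.Reasoning.Setoid as SetoidReasoning
open import Relation.Nullary using (¬_; yes; no; contradiction; does)
open import Relation.Nullary.Decidable using (_×-dec_; dec-true; dec-false; does-⇔)
open import Relation.Unary as Unary using (Pred)

open import Algebra.Properties.Semiring.Sum (CommutativeRing.semiring ℚ.+-*-commutativeRing)
  using (sum; sum-cong-≗; ∑-distrib-+; sum-permute)
open +-*-Solver using (solve; _:+_; _:*_; _:-_; :-_; _:=_; con)

-- The bound on a single Newton term cannot be compared with z: an i that is divisible by several of
-- the q may have c + M · #{q : q divides i} above z. Only averages over i = 1, ..., K are
-- controlled, so the weights have to be summed against a monotone sequence. In the convolution the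
-- small i meet the large Y_{k-i}, which is the order that Abel summation needs. The recursion of
-- Y_k is that of the coefficients of (1 - t)^(-z); this is the origin of the binomial coefficient
-- in the bound. The symmetric functions are applied to an arbitrary function f on the group and are
-- linear in f. Taking f = δ - 1/∣G∣, with δ the indicator of 0, therefore yields g_k itself:
-- Newton's identities hold for it as for any f, and total 0 passes from f to every g_k because
-- translations preserve totals. Taking f = δ gives the count and f = 1/∣G∣ gives the mean.

toℚᵘ-fromℕ : ∀ n → toℚᵘ (fromℕ n) ℚᵘ.≃ mkℚᵘ (+ n) 0
toℚᵘ-fromℕ n = ℚ.toℚᵘ-fromℚᵘ (mkℚᵘ (+ n) 0)

fromℕ-+ : ∀ m n → fromℕ (m ℕ.+ n) ≡ fromℕ m + fromℕ n
fromℕ-+ m n = ℚ.toℚᵘ-injective (begin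
  toℚᵘ (fromℕ (m ℕ.+ n))               ≈⟨ toℚᵘ-fromℕ (m ℕ.+ n) ⟩
  mkℚᵘ (+ (m ℕ.+ n)) 0                 ≈⟨ *≡* (cong (ℤ._* ℤ.1ℤ) (trans (ℤ.pos-+ m n)
      (sym (cong₂ ℤ._+_ (ℤ.*-identityʳ (+ m)) (ℤ.*-identityʳ (+ n)))))) ⟩
  mkℚᵘ (+ m) 0 ℚᵘ.+ mkℚᵘ (+ n) 0       ≈⟨ ℚᵘ.+-cong (toℚᵘ-fromℕ m) (toℚᵘ-fromℕ n) ⟨
  toℚᵘ (fromℕ m) ℚᵘ.+ toℚᵘ (fromℕ n)   ≈⟨ ℚ.toℚᵘ-homo-+ (fromℕ m) (fromℕ n) ⟨
  toℚᵘ (fromℕ m + fromℕ n)             ∎)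
  where open ℚᵘ.≃-Reasoning

fromℕ-* : ∀ m n → fromℕ (m ℕ.* n) ≡ fromℕ m * fromℕ n
fromℕ-* zero    n = sym (ℚ.*-zeroˡ (fromℕ n))
fromℕ-* (suc m) n = begin
  fromℕ (n ℕ.+ m ℕ.* n)                 ≡⟨ fromℕ-+ n (m ℕ.* n) ⟩
  fromℕ n + fromℕ (m ℕ.* n)             ≡⟨ cong (fromℕ n ℚ.+_) (fromℕ-* m n) ⟩
  fromℕ n + fromℕ m * fromℕ n           ≡⟨ cong (_+ fromℕ m * fromℕ n) (ℚ.*-identityˡ (fromℕ n)) ⟨
  1ℚ * fromℕ n + fromℕ m * fromℕ n      ≡⟨ ℚ.*-distribʳ-+ (fromℕ n) 1ℚ (fromℕ m) ⟨
  (1ℚ + fromℕ m) * fromℕ n              ≡⟨ cong (_* fromℕ n) (fromℕ-+ 1 m) ⟨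
  fromℕ (suc m) * fromℕ n               ∎
  where open ≡-Reasoning

fromℕ-suc : ∀ n → fromℕ (suc n) ≡ 1ℚ + fromℕ n
fromℕ-suc = fromℕ-+ 1

fromℕ-nonNeg : ∀ n → 0ℚ ≤ fromℕ n
fromℕ-nonNeg n = ℚ.nonNegative⁻¹ (fromℕ n) {{ℚ.normalize-nonNeg n 1}}

fromℕ-mono-≤ : ∀ {m n} → m ℕ.≤ n → fromℕ m ≤ fromℕ n
fromℕ-mono-≤ {m} {n} m≤n = begin
  fromℕ m                          ≡⟨ ℚ.+-identityʳ (fromℕ m) ⟨
  fromℕ m + 0ℚ                     ≤⟨ ℚ.+-monoʳ-≤ (fromℕ m) (fromℕ-nonNeg (n ℕ.∸ m)) ⟩
  fromℕ m + fromℕ (n ℕ.∸ m)        ≡⟨ fromℕ-+ m (n ℕ.∸ m) ⟨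
  fromℕ (m ℕ.+ (n ℕ.∸ m))          ≡⟨ cong fromℕ (ℕ.m+[n∸m]≡n m≤n) ⟩
  fromℕ n                          ∎
  where open ℚ.≤-Reasoning

1/n-nonNeg : ∀ n .{{_ : NonZero n}} → 0ℚ ≤ + 1 / n
1/n-nonNeg n = ℚ.nonNegative⁻¹ (+ 1 / n) {{ℚ.normalize-nonNeg 1 n}}

fromℕ*1/n≡1 : ∀ n .{{_ : NonZero n}} → fromℕ n * (+ 1 / n) ≡ 1ℚ
fromℕ*1/n≡1 n@(suc m) = ℚ.toℚᵘ-injective (begin
  toℚᵘ (fromℕ n * (+ 1 / n))               ≈⟨ ℚ.toℚᵘ-homo-* (fromℕ n) (+ 1 / n) ⟩
  toℚᵘ (fromℕ n) ℚᵘ.* toℚᵘ (+ 1 / n)       ≈⟨ ℚᵘ.*-cong (toℚᵘ-fromℕ n) (ℚ.toℚᵘ-fromℚᵘ (mkℚᵘ (+ 1) m)) ⟩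
  mkℚᵘ (+ n) 0 ℚᵘ.* mkℚᵘ (+ 1) m           ≈⟨ *≡* (trans (ℤ.*-identityʳ (+ n ℤ.* + 1)) (trans (ℤ.*-identityʳ (+ n))
      (sym (trans (ℤ.*-identityˡ _) (cong +_ (ℕ.*-identityˡ n)))))) ⟩
  toℚᵘ 1ℚ                                  ∎)
  where open ℚᵘ.≃-Reasoning

*-mono-≤ : ∀ {p q r s} → 0ℚ ≤ p → 0ℚ ≤ s → p ≤ q → r ≤ s → p * r ≤ q * s
*-mono-≤ {p} {q} {r} {s} 0≤p 0≤s p≤q r≤s = ℚ.≤-trans
  (ℚ.*-monoˡ-≤-nonNeg p {{ℚ.nonNegative 0≤p}} r≤s) (ℚ.*-monoʳ-≤-nonNeg s {{ℚ.nonNegative 0≤s}} p≤q)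

*-monoˡ : ∀ {p q r} → 0ℚ ≤ r → p ≤ q → r * p ≤ r * q
*-monoˡ {r = r} 0≤r = ℚ.*-monoˡ-≤-nonNeg r {{ℚ.nonNegative 0≤r}}

*-monoʳ : ∀ {p q r} → 0ℚ ≤ r → p ≤ q → p * r ≤ q * r
*-monoʳ {r = r} 0≤r = ℚ.*-monoʳ-≤-nonNeg r {{ℚ.nonNegative 0≤r}}

1/n≤1 : ∀ n .{{_ : NonZero n}} → + 1 / n ≤ 1ℚ
1/n≤1 n = begin
  + 1 / n                  ≡⟨ ℚ.*-identityˡ (+ 1 / n) ⟨
  1ℚ * (+ 1 / n)           ≤⟨ *-monoʳ (1/n-nonNeg n) (fromℕ-mono-≤ (ℕ.>-nonZero⁻¹ n)) ⟩
  fromℕ n * (+ 1 / n)      ≡⟨ fromℕ*1/n≡1 n ⟩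
  1ℚ                       ∎
  where open ℚ.≤-Reasoning

*-nonNeg : ∀ {p q} → 0ℚ ≤ p → 0ℚ ≤ q → 0ℚ ≤ p * q
*-nonNeg {p} {q} 0≤p 0≤q = subst (_≤ p * q) (ℚ.*-zeroʳ p) (*-monoˡ 0≤p 0≤q)

+-nonNeg : ∀ {p q} → 0ℚ ≤ p → 0ℚ ≤ q → 0ℚ ≤ p + q
+-nonNeg 0≤p 0≤q = ℚ.+-mono-≤ 0≤p 0≤q

*-cancel-suc : ∀ k {p q} → fromℕ (suc k) * p ≡ fromℕ (suc k) * q → p ≡ q
*-cancel-suc k {p} {q} eq = begin
  p                                       ≡⟨ lemma p ⟨
  (+ 1 / suc k) * (fromℕ (suc k) * p)     ≡⟨ cong ((+ 1 / suc k) *_) eq ⟩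
  (+ 1 / suc k) * (fromℕ (suc k) * q)     ≡⟨ lemma q ⟩
  q                                       ∎
  where
  open ≡-Reasoning
  lemma : ∀ r → (+ 1 / suc k) * (fromℕ (suc k) * r) ≡ r
  lemma r = begin
    (+ 1 / suc k) * (fromℕ (suc k) * r)   ≡⟨ ℚ.*-assoc (+ 1 / suc k) (fromℕ (suc k)) r ⟨
    (+ 1 / suc k) * fromℕ (suc k) * r     ≡⟨ cong (_* r) (trans (ℚ.*-comm (+ 1 / suc k) (fromℕ (suc k))) (fromℕ*1/n≡1 (suc k))) ⟩
    1ℚ * r                                ≡⟨ ℚ.*-identityˡ r ⟩
    r                                     ∎

sum-const : ∀ n x → sum {n} (λ _ → x) ≡ fromℕ n * x
sum-const zero    x = sym (ℚ.*-zeroˡ x)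
sum-const (suc n) x = begin
  x + sum {n} (λ _ → x)    ≡⟨ cong (x ℚ.+_) (sum-const n x) ⟩
  x + fromℕ n * x          ≡⟨ solve 2 (λ x n → x :+ n :* x := (con 1ℚ :+ n) :* x) refl x (fromℕ n) ⟩
  (1ℚ + fromℕ n) * x       ≡⟨ cong (_* x) (fromℕ-suc n) ⟨
  fromℕ (suc n) * x        ∎
  where open ≡-Reasoning

-- Generalised binomial coefficients and their recursions.

suc*1/suc! : ∀ k .{{_ : NonZero (k !)}} .{{_ : NonZero (suc k !)}} →
             fromℕ (suc k) * (+ 1 / (suc k !)) ≡ + 1 / (k !)
suc*1/suc! k = begin
  s * r                        ≡⟨ ℚ.*-identityʳ (s * r) ⟨
  s * r * 1ℚ                   ≡⟨ cong (s * r ℚ.*_) (fromℕ*1/n≡1 (k !)) ⟨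
  s * r * (f * q)              ≡⟨ solve 4 (λ s r f q → s :* r :* (f :* q) := s :* f :* r :* q) refl s r f q ⟩
  s * f * r * q                ≡⟨ cong (λ t → t * r * q) (fromℕ-* (suc k) (k !)) ⟨
  fromℕ (suc k !) * r * q      ≡⟨ cong (_* q) (fromℕ*1/n≡1 (suc k !)) ⟩
  1ℚ * q                       ≡⟨ ℚ.*-identityˡ q ⟩
  q                            ∎
  where
  open ≡-Reasoning
  s = fromℕ (suc k)
  f = fromℕ (k !)
  q = + 1 / (k !)
  r = + 1 / (suc k !)

binom-suc : ∀ x k → fromℕ (suc k) * binom x (suc k) ≡ (x - fromℕ k) * binom x k
binom-suc x k = begin
  s * (F * y * r)      ≡⟨ solve 4 (λ s F y r → s :* (F :* y :* r) := y :* (F :* (s :* r))) refl s F y r ⟩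
  y * (F * (s * r))    ≡⟨ cong (λ t → y * (F * t)) (suc*1/suc! k) ⟩
  y * binom x k        ∎
  where
  open ≡-Reasoning
  instance _ = k ℕ.!≢0
  instance _ = suc k ℕ.!≢0
  s = fromℕ (suc k)
  F = fallingFactorial x k
  y = x - fromℕ k
  r = + 1 / (suc k !)

-- `fallingFactorial` splits off its last factor; the top of `multichoose` grows together with k, so
-- its recursion needs the first factor split off instead.
fallingFactorial-shift : ∀ x k → fallingFactorial (x + 1ℚ) (suc k) ≡ (x + 1ℚ) * fallingFactorial x k
fallingFactorial-shift x zero    = solve 1 (λ x → con 1ℚ :* (x :+ con 1ℚ :- con 0ℚ) := (x :+ con 1ℚ) :* con 1ℚ) refl x
fallingFactorial-shift x (suc k) = begin
  fallingFactorial (x + 1ℚ) (suc k) * (x + 1ℚ - fromℕ (suc k))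
    ≡⟨ cong₂ (λ s t → s * (x + 1ℚ - t)) (fallingFactorial-shift x k) (fromℕ-suc k) ⟩
  (x + 1ℚ) * fallingFactorial x k * (x + 1ℚ - (1ℚ + fromℕ k))
    ≡⟨ solve 3 (λ x F k → (x :+ con 1ℚ) :* F :* (x :+ con 1ℚ :- (con 1ℚ :+ k)) := (x :+ con 1ℚ) :* (F :* (x :- k)))
         refl x (fallingFactorial x k) (fromℕ k) ⟩
  (x + 1ℚ) * (fallingFactorial x k * (x - fromℕ k))
    ∎
  where open ≡-Reasoning

-- The coefficient of t^k in (1 - t)^(-z); for an integer z ≥ 1 it counts the multisets of size k
-- from z elements.
multichoose : ℚ → ℕ → ℚ
multichoose z k = binom (z + fromℕ k - 1ℚ) k

multichoose-suc : ∀ z k → fromℕ (suc k) * multichoose z (suc k) ≡ (z + fromℕ k) * multichoose z k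
multichoose-suc z k = begin
  s * (fallingFactorial (z + s - 1ℚ) (suc k) * r)    ≡⟨ cong (λ t → s * (fallingFactorial t (suc k) * r)) top ⟩
  s * (fallingFactorial (x + 1ℚ) (suc k) * r)        ≡⟨ cong (λ t → s * (t * r)) (fallingFactorial-shift x k) ⟩
  s * ((x + 1ℚ) * F * r)
    ≡⟨ solve 5 (λ s z k F r → s :* ((z :+ k :- con 1ℚ :+ con 1ℚ) :* F :* r) := (z :+ k) :* (F :* (s :* r)))
         refl s z (fromℕ k) F r ⟩
  (z + fromℕ k) * (F * (s * r))                      ≡⟨ cong (λ t → (z + fromℕ k) * (F * t)) (suc*1/suc! k) ⟩
  (z + fromℕ k) * multichoose z k                    ∎
  where
  open ≡-Reasoning
  instance _ = k ℕ.!≢0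
  instance _ = suc k ℕ.!≢0
  s = fromℕ (suc k)
  x = z + fromℕ k - 1ℚ
  F = fallingFactorial x k
  r = + 1 / (suc k !)
  top : z + s - 1ℚ ≡ x + 1ℚ
  top = trans (cong (λ t → z + t - 1ℚ) (fromℕ-suc k))
    (solve 2 (λ z k → z :+ (con 1ℚ :+ k) :- con 1ℚ := z :+ k :- con 1ℚ :+ con 1ℚ) refl z (fromℕ k))

*-cancel-≤-suc : ∀ k {p q} → fromℕ (suc k) * p ≤ fromℕ (suc k) * q → p ≤ q
*-cancel-≤-suc k = ℚ.*-cancelˡ-≤-pos (fromℕ (suc k)) {{ℚ.normalize-pos (suc k) 1}}

multichoose-nonNeg : ∀ {z} → 0ℚ ≤ z → ∀ k → 0ℚ ≤ multichoose z k
multichoose-nonNeg         0≤z zero    = ℚ.nonNegative⁻¹ 1ℚ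
multichoose-nonNeg {z = z} 0≤z (suc k) = *-cancel-≤-suc k (begin
  fromℕ (suc k) * 0ℚ                     ≡⟨ ℚ.*-zeroʳ (fromℕ (suc k)) ⟩
  0ℚ                                     ≤⟨ *-nonNeg (+-nonNeg 0≤z (fromℕ-nonNeg k)) (multichoose-nonNeg 0≤z k) ⟩
  (z + fromℕ k) * multichoose z k        ≡⟨ multichoose-suc z k ⟨
  fromℕ (suc k) * multichoose z (suc k)  ∎)
  where open ℚ.≤-Reasoning

-- The ratio of consecutive values is (z + k) / (1 + k).
multichoose-mono : ∀ {z} → 1ℚ ≤ z → ∀ k → multichoose z k ≤ multichoose z (suc k)
multichoose-mono {z} 1≤z k = *-cancel-≤-suc k (begin
  fromℕ (suc k) * multichoose z k          ≡⟨ cong (_* multichoose z k) (fromℕ-suc k) ⟩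
  (1ℚ + fromℕ k) * multichoose z k         ≤⟨ *-monoʳ (multichoose-nonNeg 0≤z k) (ℚ.+-monoˡ-≤ (fromℕ k) 1≤z) ⟩
  (z + fromℕ k) * multichoose z k          ≡⟨ multichoose-suc z k ⟨
  fromℕ (suc k) * multichoose z (suc k)    ∎)
  where
  open ℚ.≤-Reasoning
  0≤z = ℚ.≤-trans (ℚ.nonNegative⁻¹ 1ℚ) 1≤z

-- Convolutions and Abel summation.

p≤q⇒0≤q-p : ∀ {p q} → p ≤ q → 0ℚ ≤ q - p
p≤q⇒0≤q-p {p} {q} p≤q = subst (_≤ q - p) (ℚ.+-inverseʳ p) (ℚ.+-monoˡ-≤ (- p) p≤q)

-- convolution u Y j K is the sum of u (j + i) * Y (K - i) over 1 ≤ i ≤ K.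
convolution : (ℕ → ℚ) → (ℕ → ℚ) → ℕ → ℕ → ℚ
convolution u Y j zero    = 0ℚ
convolution u Y j (suc k) = u (suc j) * Y k + convolution u Y (suc j) k

convolution-distrib-+ : ∀ {u v w : ℕ → ℚ} Y → (∀ i → w i ≡ u i + v i) → ∀ j k →
                        convolution w Y j k ≡ convolution u Y j k + convolution v Y j k
convolution-distrib-+ Y w≡ j zero = refl
convolution-distrib-+ {u} {v} Y w≡ j (suc k) = trans
  (cong₂ (λ s t → s * Y k + t) (w≡ (suc j)) (convolution-distrib-+ {u} {v} Y w≡ (suc j) k))
  (solve 5 (λ a b y c d → (a :+ b) :* y :+ (c :+ d) := a :* y :+ c :+ (b :* y :+ d)) refl
     (u (suc j)) (v (suc j)) (Y k) (convolution u Y (suc j) k) (convolution v Y (suc j) k))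

-- Compares the coefficients of t^k in t Y' = z (t / (1 - t)) Y for the generating function Y = (1 -
-- t)^(-z). The offset j has no effect on a constant weight, but the recursion moves it.
convolution-multichoose : ∀ z j k → convolution (λ _ → z) (multichoose z) j k ≡ fromℕ k * multichoose z k
convolution-multichoose z j zero    = refl
convolution-multichoose z j (suc k) = begin
  z * Y k + convolution (λ _ → z) Y (suc j) k   ≡⟨ cong (z * Y k ℚ.+_) (convolution-multichoose z (suc j) k) ⟩
  z * Y k + fromℕ k * Y k                       ≡⟨ ℚ.*-distribʳ-+ (Y k) z (fromℕ k) ⟨
  (z + fromℕ k) * Y k                           ≡⟨ multichoose-suc z k ⟨
  fromℕ (suc k) * Y (suc k)                     ∎
  where
  open ≡-Reasoning
  Y = multichoose z

partialSum : (ℕ → ℚ) → ℕ → ℚ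
partialSum h zero    = 0ℚ
partialSum h (suc j) = partialSum h j + h (suc j)

-- Abel summation, peeled from the front with the partial sum as accumulator.
partialSum+convolution-nonNeg :
  ∀ h Y → (∀ j → 0ℚ ≤ partialSum h j) → (∀ k → 0ℚ ≤ Y k) → (∀ k → Y k ≤ Y (suc k)) →
  ∀ j k → 0ℚ ≤ partialSum h j * Y k + convolution h Y j k
partialSum+convolution-nonNeg h Y h≥0 Y≥0 Y-mono j zero    = +-nonNeg (*-nonNeg (h≥0 j) (Y≥0 0)) ℚ.≤-refl
partialSum+convolution-nonNeg h Y h≥0 Y≥0 Y-mono j (suc k) = begin
  0ℚ                                                                     ≤⟨ partialSum+convolution-nonNeg h Y h≥0 Y≥0 Y-mono (suc j) k ⟩
  (partialSum h j + h (suc j)) * Y k + convolution h Y (suc j) k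
    ≡⟨ solve 4 (λ p u y c → (p :+ u) :* y :+ c := p :* y :+ (u :* y :+ c)) refl (partialSum h j) (h (suc j)) (Y k) _ ⟩
  -- Monotonicity enters here: the factor of the nonnegative accumulator may be raised from `Y k` to
  -- `Y (suc k)`.
  partialSum h j * Y k + convolution h Y j (suc k)                       ≤⟨ ℚ.+-monoˡ-≤ _ (*-monoˡ (h≥0 j) (Y-mono k)) ⟩
  partialSum h j * Y (suc k) + convolution h Y j (suc k)                 ∎
  where open ℚ.≤-Reasoning

convolution-nonNeg : ∀ h Y → (∀ j → 0ℚ ≤ partialSum h j) → (∀ k → 0ℚ ≤ Y k) → (∀ k → Y k ≤ Y (suc k)) →
                     ∀ k → 0ℚ ≤ convolution h Y 0 k
convolution-nonNeg h Y h≥0 Y≥0 Y-mono k = subst (0ℚ ≤_)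
  (trans (cong (_+ convolution h Y 0 k) (ℚ.*-zeroˡ (Y k))) (ℚ.+-identityˡ _))
  (partialSum+convolution-nonNeg h Y h≥0 Y≥0 Y-mono 0 k)

-- Counting multiples of the divisors q of e with μ(q) = -1.

sumOver : List ℕ → (ℕ → ℚ) → ℚ
sumOver js f = foldr ℚ._+_ 0ℚ (map f js)

sumOver-nonNeg : ∀ {f} → (∀ j → 0ℚ ≤ f j) → ∀ js → 0ℚ ≤ sumOver js f
sumOver-nonNeg f≥0 []       = ℚ.≤-refl
sumOver-nonNeg f≥0 (j ∷ js) = +-nonNeg (f≥0 j) (sumOver-nonNeg f≥0 js)

∈⇒≤sumOver : ∀ {f} → (∀ j → 0ℚ ≤ f j) → ∀ {j js} → j ∈ js → f j ≤ sumOver js f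
∈⇒≤sumOver {f} f≥0 {j} {_ ∷ js} (here refl) = subst (_≤ f j + sumOver js f) (ℚ.+-identityʳ (f j))
  (ℚ.+-monoʳ-≤ (f j) (sumOver-nonNeg f≥0 js))
∈⇒≤sumOver {f} f≥0 {j} {i ∷ js} (there j∈js) = subst (_≤ f i + sumOver js f) (ℚ.+-identityˡ (f j))
  (ℚ.+-mono-≤ (f≥0 i) (∈⇒≤sumOver f≥0 j∈js))

-- The divisor is suc q, as in negMöbiusSum.
isMultiple : ℕ → ℕ → ℚ
isMultiple i q = if does (suc q ∣? i) then 1ℚ else 0ℚ

isMultiple-nonNeg : ∀ i q → 0ℚ ≤ isMultiple i q
isMultiple-nonNeg i q with does (suc q ∣? i)
... | true  = ℚ.nonNegative⁻¹ 1ℚ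
... | false = ℚ.≤-refl

isMultiple-true : ∀ {i q} → suc q ∣ i → isMultiple i q ≡ 1ℚ
isMultiple-true {i} {q} q∣i rewrite dec-true (suc q ∣? i) q∣i = refl

isMultiple-false : ∀ {i q} → ¬ suc q ∣ i → isMultiple i q ≡ 0ℚ
isMultiple-false {i} {q} q∤i rewrite dec-false (suc q ∣? i) q∤i = refl

-- The quotient m and the remainder r of K modulo `suc q` are carried along the induction; the count
-- of multiples increases exactly when r wraps around from q to 0.
partialSum-isMultiple : ∀ q K → ∃₂ λ m r → m ℕ.* suc q ℕ.+ r ≡ K × r ℕ.≤ q ×
                        partialSum (λ i → isMultiple i q) K ≡ fromℕ m
partialSum-isMultiple q zero = 0 , 0 , refl , ℕ.z≤n , refl
partialSum-isMultiple q (suc K) with partialSum-isMultiple q K | suc q ∣? suc K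
... | m , r , refl , r≤q , eq | yes q∣ = suc m , 0 , trans (ℕ.+-identityʳ _) (cong suc (trans (ℕ.+-comm q _) (cong (m ℕ.* suc q ℕ.+_) (sym r≡q)))) , ℕ.z≤n ,
  trans (cong₂ _+_ eq (isMultiple-true q∣)) (trans (ℚ.+-comm (fromℕ m) 1ℚ) (sym (fromℕ-suc m)))
  where
  -- `suc q` divides `m * suc q + suc r`, hence `suc r`, and `r ≤ q` leaves only equality.
  r≡q : r ≡ q
  r≡q = ℕ.≤-antisym r≤q (ℕ.≤-pred (∣⇒≤ (∣m+n∣m⇒∣n (subst (suc q ∣_) (sym (ℕ.+-suc (m ℕ.* suc q) r)) q∣) (n∣m*n m))))
... | m , r , refl , r≤q , eq | no ¬q∣ = m , suc r , ℕ.+-suc _ r , ℕ.≤∧≢⇒< r≤q r≢q , trans (cong₂ _+_ eq (isMultiple-false ¬q∣)) (ℚ.+-identityʳ (fromℕ m))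
  where
  r≢q : r ≢ q
  r≢q refl = ¬q∣ (divides (suc m) (cong suc (ℕ.+-comm _ r)))

partialSum-isMultiple-≤ : ∀ q K → partialSum (λ i → isMultiple i q) K ≤ fromℕ K * (+ 1 / suc q)
partialSum-isMultiple-≤ q K with m , r , refl , _ , eq ← partialSum-isMultiple q K = begin
  partialSum (λ i → isMultiple i q) K           ≡⟨ eq ⟩
  fromℕ m                                       ≡⟨ ℚ.*-identityʳ (fromℕ m) ⟨
  fromℕ m * 1ℚ                                  ≡⟨ cong (fromℕ m ℚ.*_) (fromℕ*1/n≡1 (suc q)) ⟨
  fromℕ m * (fromℕ (suc q) * (+ 1 / suc q))     ≡⟨ ℚ.*-assoc (fromℕ m) (fromℕ (suc q)) (+ 1 / suc q) ⟨
  fromℕ m * fromℕ (suc q) * (+ 1 / suc q)       ≡⟨ cong (_* (+ 1 / suc q)) (fromℕ-* m (suc q)) ⟨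
  fromℕ (m ℕ.* suc q) * (+ 1 / suc q)           ≤⟨ *-monoʳ (1/n-nonNeg (suc q)) (fromℕ-mono-≤ (ℕ.m≤m+n (m ℕ.* suc q) r)) ⟩
  fromℕ K * (+ 1 / suc q)                       ∎
  where open ℚ.≤-Reasoning

divisorCount : List ℕ → ℕ → ℚ
divisorCount js i = sumOver js (isMultiple i)

reciprocalSum : List ℕ → ℚ
reciprocalSum js = sumOver js (λ j → + 1 / suc j)

partialSum-divisorCount-≤ : ∀ js K → partialSum (divisorCount js) K ≤ fromℕ K * reciprocalSum js
partialSum-divisorCount-≤ []       K = ℚ.≤-reflexive (trans (zeros K) (sym (ℚ.*-zeroʳ (fromℕ K))))
  where
  zeros : ∀ K → partialSum (divisorCount []) K ≡ 0ℚ
  zeros zero    = refl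
  zeros (suc K) = trans (ℚ.+-identityʳ _) (zeros K)
partialSum-divisorCount-≤ (j ∷ js) K = begin
  partialSum (divisorCount (j ∷ js)) K                                  ≡⟨ distrib K ⟩
  partialSum (λ i → isMultiple i j) K + partialSum (divisorCount js) K  ≤⟨ ℚ.+-mono-≤ (partialSum-isMultiple-≤ j K) (partialSum-divisorCount-≤ js K) ⟩
  fromℕ K * (+ 1 / suc j) + fromℕ K * reciprocalSum js                  ≡⟨ ℚ.*-distribˡ-+ (fromℕ K) (+ 1 / suc j) (reciprocalSum js) ⟨
  fromℕ K * reciprocalSum (j ∷ js)                                      ∎
  where
  open ℚ.≤-Reasoning
  distrib : ∀ K → partialSum (divisorCount (j ∷ js)) K ≡ partialSum (λ i → isMultiple i j) K + partialSum (divisorCount js) K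
  distrib zero    = refl
  distrib (suc K) = trans (cong (_+ divisorCount (j ∷ js) (suc K)) (distrib K))
    (solve 4 (λ a b c d → a :+ b :+ (c :+ d) := a :+ c :+ (b :+ d)) refl
      (partialSum (λ i → isMultiple i j) K) (partialSum (divisorCount js) K) (isMultiple (suc K) j) (divisorCount js (suc K)))

-- The where-bound list of negMöbiusSum, so that negMöbiusSum e and
-- reciprocalSum (negMöbiusIndices e) agree by computation.
negMöbiusIndices : ℕ → List ℕ
negMöbiusIndices e = filter (λ j → (suc j ∣? e) ×-dec (μ (suc j) ℤ.≟ -1ℤ)) (upTo e)

-- The factor list of a variable p does not compute; uniqueness of the factorisation identifies it
-- with `[ p ]`, on which the definition of `μ` reduces.
μ-prime : ∀ {p} .{{_ : NonZero p}} → Prime p → μ p ≡ -1ℤ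
μ-prime {p} p-prime = cong (λ ps → if does (unique? ℕ._≟_ ps) then -1ℤ ℤ.^ length ps else ℤ.0ℤ)
  (↭-singleton-inv (factorisationUnique (factorise p) (primeFactorisation[p] p-prime)))

prime∣⇒∈negMöbiusIndices : ∀ {j e} .{{_ : NonZero e}} → Prime (suc j) → suc j ∣ e → j ∈ negMöbiusIndices e
prime∣⇒∈negMöbiusIndices {j} {e} p-prime p∣e = ∈-filter⁺ (λ j → (suc j ∣? e) ×-dec (μ (suc j) ℤ.≟ -1ℤ))
  (∈-upTo⁺ (∣⇒≤ p∣e)) (p∣e , μ-prime p-prime)

∃prime∣ : ∀ n .{{_ : NonZero n}} → n ≢ 1 → ∃[ j ] Prime (suc j) × suc j ∣ n
∃prime∣ n n≢1 = go (factors f) (PrimeFactorisation.isFactorisation f) (PrimeFactorisation.factorsPrime f)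
  where
  f = factorise n
  go : ∀ ps → n ≡ product ps → All Prime ps → ∃[ j ] Prime (suc j) × suc j ∣ n
  go []           n≡ _           = contradiction n≡ n≢1
  go (suc j ∷ ps) n≡ (pp ∷ _) = j , pp , divides (product ps) (trans n≡ (ℕ.*-comm (suc j) (product ps)))
  go (zero  ∷ ps) n≡ (pp ∷ _) = contradiction refl (ℕ.≢-nonZero⁻¹ 0 {{prime⇒nonZero pp}})

-- A prime factor of `gcd i e` contributes 1 on its own, and all other terms are nonnegative.
divisorCount-¬coprime : ∀ {i e} .{{_ : NonZero e}} → ¬ Coprime i e → 1ℚ ≤ divisorCount (negMöbiusIndices e) i
divisorCount-¬coprime {i} {e} ¬coprime
  with j , p-prime , p∣g ← ∃prime∣ (gcd i e) {{ℕ.≢-nonZero (λ g≡0 → ℕ.≢-nonZero⁻¹ e (gcd[m,n]≡0⇒n≡0 i g≡0))}} (λ g≡1 → ¬coprime (gcd≡1⇒coprime g≡1))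
  = subst (_≤ divisorCount (negMöbiusIndices e) i) (isMultiple-true (∣-trans p∣g (gcd[m,n]∣m i e)))
      (∈⇒≤sumOver (isMultiple-nonNeg i) (prime∣⇒∈negMöbiusIndices p-prime (∣-trans p∣g (gcd[m,n]∣n i e))))

-- Sums over a subset of `Fin n` and its complement.

sumIn : ∀ {n} → Subset n → (Fin n → ℚ) → ℚ
sumIn D g = sum (λ i → if lookup D i then g i else 0ℚ)

sumIn-cong : ∀ {n} (D : Subset n) {g h} → (∀ i → g i ≡ h i) → sumIn D g ≡ sumIn D h
sumIn-cong D g≡h = sum-cong-≗ (λ i → cong (if lookup D i then_else 0ℚ) (g≡h i))

sumIn-zero : ∀ {n} (D : Subset n) → sumIn D (λ _ → 0ℚ) ≡ 0ℚ
sumIn-zero []            = refl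
sumIn-zero (inside ∷ D)  = trans (ℚ.+-identityˡ _) (sumIn-zero D)
sumIn-zero (outside ∷ D) = trans (ℚ.+-identityˡ _) (sumIn-zero D)

sumIn-distrib-+ : ∀ {n} (D : Subset n) g h → sumIn D (λ i → g i + h i) ≡ sumIn D g + sumIn D h
sumIn-distrib-+ []            g h = refl
sumIn-distrib-+ (inside ∷ D)  g h = trans (cong (g zero + h zero ℚ.+_) (sumIn-distrib-+ D (g ∘ suc) (h ∘ suc)))
  (solve 4 (λ a b c d → a :+ b :+ (c :+ d) := a :+ c :+ (b :+ d)) refl (g zero) (h zero) (sumIn D (g ∘ suc)) (sumIn D (h ∘ suc)))
sumIn-distrib-+ (outside ∷ D) g h = trans (cong (0ℚ ℚ.+_) (sumIn-distrib-+ D (g ∘ suc) (h ∘ suc)))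
  (solve 2 (λ c d → con 0ℚ :+ (c :+ d) := con 0ℚ :+ c :+ (con 0ℚ :+ d)) refl (sumIn D (g ∘ suc)) (sumIn D (h ∘ suc)))

sumIn-distrib-- : ∀ {n} (D : Subset n) g h → sumIn D (λ i → g i - h i) ≡ sumIn D g - sumIn D h
sumIn-distrib-- D g h = begin
  sumIn D (λ i → g i - h i)                           ≡⟨ solve 2 (λ a b → a := a :+ b :- b) refl _ (sumIn D h) ⟩
  sumIn D (λ i → g i - h i) + sumIn D h - sumIn D h   ≡⟨ cong (_- sumIn D h) (sumIn-distrib-+ D (λ i → g i - h i) h) ⟨
  sumIn D (λ i → g i - h i + h i) - sumIn D h         ≡⟨ cong (_- sumIn D h) (sumIn-cong D (λ i →
                                                           solve 2 (λ a b → a :- b :+ b := a) refl (g i) (h i))) ⟩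
  sumIn D g - sumIn D h                               ∎
  where open ≡-Reasoning

sumIn+sumIn-∁ : ∀ {n} (D : Subset n) g → sumIn D g + sumIn (∁ D) g ≡ sum g
sumIn+sumIn-∁ []            g = refl
sumIn+sumIn-∁ (inside ∷ D)  g = trans
  (solve 3 (λ a c d → a :+ c :+ (con 0ℚ :+ d) := a :+ (c :+ d)) refl (g zero) (sumIn D (g ∘ suc)) (sumIn (∁ D) (g ∘ suc)))
  (cong (g zero ℚ.+_) (sumIn+sumIn-∁ D (g ∘ suc)))
sumIn+sumIn-∁ (outside ∷ D) g = trans
  (solve 3 (λ a c d → con 0ℚ :+ c :+ (a :+ d) := a :+ (c :+ d)) refl (g zero) (sumIn D (g ∘ suc)) (sumIn (∁ D) (g ∘ suc)))
  (cong (g zero ℚ.+_) (sumIn+sumIn-∁ D (g ∘ suc)))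

∣sumIn∣≤ : ∀ {n} (D : Subset n) g {y} → (∀ i → ℚ.∣ g i ∣ ≤ y) → ℚ.∣ sumIn D g ∣ ≤ fromℕ ∣ D ∣ * y
∣sumIn∣≤ []            g {y} ∣g∣≤y = ℚ.≤-reflexive (sym (ℚ.*-zeroˡ y))
∣sumIn∣≤ (inside ∷ D)  g {y} ∣g∣≤y = begin
  ℚ.∣ g zero + sumIn D (g ∘ suc) ∣           ≤⟨ ℚ.∣p+q∣≤∣p∣+∣q∣ (g zero) (sumIn D (g ∘ suc)) ⟩
  ℚ.∣ g zero ∣ + ℚ.∣ sumIn D (g ∘ suc) ∣     ≤⟨ ℚ.+-mono-≤ (∣g∣≤y zero) (∣sumIn∣≤ D (g ∘ suc) (∣g∣≤y ∘ suc)) ⟩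
  y + d * y                                  ≡⟨ solve 2 (λ y d → y :+ d :* y := (con 1ℚ :+ d) :* y) refl y d ⟩
  (1ℚ + d) * y                               ≡⟨ cong (_* y) 1+d ⟨
  d⁺ * y                                     ∎
  where
  open ℚ.≤-Reasoning
  d  = fromℕ ∣ D ∣
  d⁺ = fromℕ (suc ∣ D ∣)
  1+d : d⁺ ≡ 1ℚ + d
  1+d = fromℕ-suc ∣ D ∣
∣sumIn∣≤ (outside ∷ D) g {y} ∣g∣≤y = subst (λ s → ℚ.∣ s ∣ ≤ fromℕ ∣ D ∣ * y) (sym (ℚ.+-identityˡ _)) (∣sumIn∣≤ D (g ∘ suc) (∣g∣≤y ∘ suc))

-- Elementary symmetric functions in the group ring and Newton's identities.

module Elementary {a ℓ} (A : AbelianGroup a ℓ) where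
  open AbelianGroup A using (Carrier; _≈_; assoc; comm; ∙-cong; ∙-congˡ; identityʳ; ⁻¹-cong; setoid)
    renaming (_∙_ to _⊕_; _-_ to _⊖_; _⁻¹ to neg; refl to ≈-refl; sym to ≈-sym; trans to ≈-trans)
  open RawMonoidDefs (AbelianGroup.rawMonoid A) using () renaming (_×_ to _·_)
  open AbelianGroupProperties A using (⁻¹-∙-comm)

  ⊖-congˡ : ∀ {b x y} → x ≈ y → b ⊖ x ≈ b ⊖ y
  ⊖-congˡ x≈y = ∙-congˡ (⁻¹-cong x≈y)

  ⊖-congʳ : ∀ {b c x} → b ≈ c → b ⊖ x ≈ c ⊖ x
  ⊖-congʳ b≈c = ∙-cong b≈c ≈-refl

  ⊖-⊖ : ∀ b x y → b ⊖ x ⊖ y ≈ b ⊖ (x ⊕ y)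
  ⊖-⊖ b x y = ≈-trans (assoc b (neg x) (neg y)) (∙-congˡ (⁻¹-∙-comm x y))

  ⊖-comm : ∀ b x y → b ⊖ x ⊖ y ≈ b ⊖ y ⊖ x
  ⊖-comm b x y = ≈-trans (⊖-⊖ b x y) (≈-trans (⊖-congˡ (comm x y)) (≈-sym (⊖-⊖ b y x)))

  Congruent : (Carrier → ℚ) → Set _
  Congruent f = ∀ {b c} → b ≈ c → f b ≡ f c

  -- elementary f x D k b is the sum of f (b - ∑_{i ∈ S} x i) over the k-subsets S of D: in the
  -- group ring, the k-th elementary symmetric polynomial of the family x on D applied to f.
  elementary : (Carrier → ℚ) → ∀ {n} → (Fin n → Carrier) → Subset n → ℕ → Carrier → ℚ
  elementary f x []            zero    b = f b
  elementary f x []            (suc k) b = 0ℚ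
  elementary f x (outside ∷ D) k       b = elementary f (x ∘ suc) D k b
  elementary f x (inside ∷ D)  zero    b = elementary f (x ∘ suc) D zero b
  elementary f x (inside ∷ D)  (suc k) b = elementary f (x ∘ suc) D (suc k) b + elementary f (x ∘ suc) D k (b ⊖ x zero)

  elementary-zero : ∀ f {n} (x : Fin n → Carrier) D b → elementary f x D 0 b ≡ f b
  elementary-zero f x []            b = refl
  elementary-zero f x (inside ∷ D)  b = elementary-zero f (x ∘ suc) D b
  elementary-zero f x (outside ∷ D) b = elementary-zero f (x ∘ suc) D b

  elementary-cong : ∀ {f} → Congruent f → ∀ {n} (x : Fin n → Carrier) D k → Congruent (elementary f x D k)
  elementary-cong f-cong x []            zero    b≈c = f-cong b≈c
  elementary-cong f-cong x []            (suc k) b≈c = refl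
  elementary-cong f-cong x (outside ∷ D) k       b≈c = elementary-cong f-cong (x ∘ suc) D k b≈c
  elementary-cong f-cong x (inside ∷ D)  zero    b≈c = elementary-cong f-cong (x ∘ suc) D zero b≈c
  elementary-cong f-cong x (inside ∷ D)  (suc k) b≈c = cong₂ _+_
    (elementary-cong f-cong (x ∘ suc) D (suc k) b≈c) (elementary-cong f-cong (x ∘ suc) D k (⊖-congʳ b≈c))

  elementary-distrib-- : ∀ f g {n} (x : Fin n → Carrier) D k b →
    elementary (λ c → f c - g c) x D k b ≡ elementary f x D k b - elementary g x D k b
  elementary-distrib-- f g x []            zero    b = refl
  elementary-distrib-- f g x []            (suc k) b = refl
  elementary-distrib-- f g x (outside ∷ D) k       b = elementary-distrib-- f g (x ∘ suc) D k b
  elementary-distrib-- f g x (inside ∷ D)  zero    b = elementary-distrib-- f g (x ∘ suc) D zero b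
  elementary-distrib-- f g x (inside ∷ D)  (suc k) b = trans
    (cong₂ _+_ (elementary-distrib-- f g (x ∘ suc) D (suc k) b) (elementary-distrib-- f g (x ∘ suc) D k (b ⊖ x zero)))
    (solve 4 (λ p q r s → p :- q :+ (r :- s) := p :+ r :- (q :+ s)) refl
       (elementary f (x ∘ suc) D (suc k) b) (elementary g (x ∘ suc) D (suc k) b)
       (elementary f (x ∘ suc) D k (b ⊖ x zero)) (elementary g (x ∘ suc) D k (b ⊖ x zero)))

  -- Constants are invariant under translation, so the value does not depend on the point. The two
  -- points b and c make the induction prove this independence together with the recursion, which is
  -- that of `binom-suc`.
  elementary-const-suc : ∀ p {n} (x : Fin n → Carrier) D k b c →
    fromℕ (suc k) * elementary (λ _ → p) x D (suc k) b ≡ (fromℕ ∣ D ∣ - fromℕ k) * elementary (λ _ → p) x D k c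
  elementary-const-suc p x []            zero    b c = solve 1 (λ p → con 1ℚ :* con 0ℚ := (con 0ℚ :- con 0ℚ) :* p) refl p
  elementary-const-suc p x []            (suc k) b c = trans (ℚ.*-zeroʳ (fromℕ (suc (suc k)))) (sym (ℚ.*-zeroʳ (0ℚ - fromℕ (suc k))))
  elementary-const-suc p x (outside ∷ D) k       b c = elementary-const-suc p (x ∘ suc) D k b c
  elementary-const-suc p x (inside ∷ D)  zero    b c = begin
    1ℚ * (u + v)                      ≡⟨ solve 2 (λ u v → con 1ℚ :* (u :+ v) := con 1ℚ :* u :+ v) refl u v ⟩
    1ℚ * u + v                        ≡⟨ cong₂ _+_ (elementary-const-suc p (x ∘ suc) D 0 b c) v≡w ⟩
    (fromℕ ∣ D ∣ - 0ℚ) * w + w        ≡⟨ solve 2 (λ d w → (d :- con 0ℚ) :* w :+ w := (con 1ℚ :+ d :- con 0ℚ) :* w) refl (fromℕ ∣ D ∣) w ⟩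
    (1ℚ + fromℕ ∣ D ∣ - 0ℚ) * w       ≡⟨ cong (λ t → (t - 0ℚ) * w) (fromℕ-suc ∣ D ∣) ⟨
    (fromℕ (suc ∣ D ∣) - 0ℚ) * w      ∎
    where
    open ≡-Reasoning
    u = elementary (λ _ → p) (x ∘ suc) D 1 b
    v = elementary (λ _ → p) (x ∘ suc) D 0 (b ⊖ x zero)
    w = elementary (λ _ → p) (x ∘ suc) D 0 c
    v≡w : v ≡ w
    v≡w = trans (elementary-zero _ (x ∘ suc) D _) (sym (elementary-zero _ (x ∘ suc) D c))
  elementary-const-suc p x (inside ∷ D)  (suc k) b c = begin
    fromℕ (suc (suc k)) * (u + v)     ≡⟨ ℚ.*-distribˡ-+ (fromℕ (suc (suc k))) u v ⟩
    fromℕ (suc (suc k)) * u + fromℕ (suc (suc k)) * v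
      ≡⟨ cong₂ _+_ (elementary-const-suc p (x ∘ suc) D (suc k) b c) (cong (_* v) (fromℕ-suc (suc k))) ⟩
    (d - fromℕ (suc k)) * w + (1ℚ + fromℕ (suc k)) * v
      ≡⟨ cong (λ t → (d - fromℕ (suc k)) * w + t) (trans (ℚ.*-distribʳ-+ v 1ℚ (fromℕ (suc k)))
           (cong (1ℚ * v ℚ.+_) IHv)) ⟩
    (d - fromℕ (suc k)) * w + (1ℚ * v + (d - fromℕ k) * y)
      ≡⟨ cong (λ t → (d - fromℕ (suc k)) * w + (1ℚ * t + (d - fromℕ k) * y)) v≡w ⟩
    (d - fromℕ (suc k)) * w + (1ℚ * w + (d - fromℕ k) * y)
      ≡⟨ cong (λ t → (d - t) * w + (1ℚ * w + (d - fromℕ k) * y)) (fromℕ-suc k) ⟩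
    (d - (1ℚ + fromℕ k)) * w + (1ℚ * w + (d - fromℕ k) * y)
      ≡⟨ solve 4 (λ d k w y → (d :- (con 1ℚ :+ k)) :* w :+ (con 1ℚ :* w :+ (d :- k) :* y) :=
           (con 1ℚ :+ d :- (con 1ℚ :+ k)) :* (w :+ y)) refl d (fromℕ k) w y ⟩
    (1ℚ + d - (1ℚ + fromℕ k)) * (w + y)
      ≡⟨ cong₂ (λ s t → (s - t) * (w + y)) (fromℕ-suc ∣ D ∣) (fromℕ-suc k) ⟨
    (fromℕ (suc ∣ D ∣) - fromℕ (suc k)) * (w + y) ∎
    where
    open ≡-Reasoning
    d = fromℕ ∣ D ∣
    u = elementary (λ _ → p) (x ∘ suc) D (suc (suc k)) b
    v = elementary (λ _ → p) (x ∘ suc) D (suc k) (b ⊖ x zero)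
    w = elementary (λ _ → p) (x ∘ suc) D (suc k) c
    y = elementary (λ _ → p) (x ∘ suc) D k (c ⊖ x zero)
    IHv : fromℕ (suc k) * v ≡ (d - fromℕ k) * y
    IHv = elementary-const-suc p (x ∘ suc) D k _ _
    -- By the induction hypothesis from two different points, both sides become `(d - fromℕ k) * y`
    -- after multiplication by `suc k`.
    v≡w : v ≡ w
    v≡w = *-cancel-suc k (trans IHv (sym (elementary-const-suc p (x ∘ suc) D k c (c ⊖ x zero))))

  elementary-const : ∀ p {n} (x : Fin n → Carrier) D k b → elementary (λ _ → p) x D k b ≡ p * binom (fromℕ ∣ D ∣) k
  elementary-const p x D zero    b = trans (elementary-zero _ x D b) (sym (ℚ.*-identityʳ p))
  elementary-const p x D (suc k) b = *-cancel-suc k (begin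
    fromℕ (suc k) * elementary (λ _ → p) x D (suc k) b   ≡⟨ elementary-const-suc p x D k b b ⟩
    (d - fromℕ k) * elementary (λ _ → p) x D k b         ≡⟨ cong ((d - fromℕ k) ℚ.*_) (elementary-const p x D k b) ⟩
    (d - fromℕ k) * (p * binom d k)                      ≡⟨ solve 3 (λ s p t → s :* (p :* t) := p :* (s :* t)) refl (d - fromℕ k) p (binom d k) ⟩
    p * ((d - fromℕ k) * binom d k)                      ≡⟨ cong (p ℚ.*_) (binom-suc d k) ⟨
    p * (fromℕ (suc k) * binom d (suc k))                ≡⟨ solve 3 (λ s p t → p :* (s :* t) := s :* (p :* t)) refl (fromℕ (suc k)) p (binom d (suc k)) ⟩
    fromℕ (suc k) * (p * binom d (suc k))                ∎)
    where
    open ≡-Reasoning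
    d = fromℕ ∣ D ∣

  -- alternating F y j K b is the sum of (-1)^{i-1} F (K - i) (b - (j + i) y) over 1 ≤ i ≤ K.
  alternating : (ℕ → Carrier → ℚ) → Carrier → ℕ → ℕ → Carrier → ℚ
  alternating F y j zero    b = 0ℚ
  alternating F y j (suc k) b = F k (b ⊖ suc j · y) - alternating F y (suc j) k b

  module _ {f} (f-cong : Congruent f) {n} (x : Fin (suc n) → Carrier) (D : Subset n) where
    private
      F⁺ = elementary f x (inside ∷ D)
      F  = elementary f (x ∘ suc) D

      F-cong : ∀ k → Congruent (F k)
      F-cong = elementary-cong f-cong (x ∘ suc) D

    -- A telescoping sum: writing x for the shift by the adjoined element, the product x^i F⁺(k-i)
    -- equals x^i F(k-i) + x^(i+1) F(k-i-1), and with alternating signs only the first part of the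
    -- first term survives.
    alternating-self : ∀ j k b → alternating F⁺ (x zero) j (suc k) b ≡ F k (b ⊖ suc j · x zero)
    alternating-self j zero    b = ℚ.+-identityʳ _
    alternating-self j (suc k) b = begin
      F (suc k) c + F k (c ⊖ x zero) - alternating F⁺ (x zero) (suc j) (suc k) b
        ≡⟨ cong (λ t → F (suc k) c + F k (c ⊖ x zero) - t) (alternating-self (suc j) k b) ⟩
      F (suc k) c + F k (c ⊖ x zero) - F k (b ⊖ suc (suc j) · x zero)
        ≡⟨ cong (λ t → F (suc k) c + F k (c ⊖ x zero) - t) (F-cong k (≈-trans (⊖-congˡ (comm _ _)) (≈-sym (⊖-⊖ b _ _)))) ⟩
      F (suc k) c + F k (c ⊖ x zero) - F k (c ⊖ x zero)
        ≡⟨ solve 2 (λ p q → p :+ q :- q := p) refl (F (suc k) c) (F k (c ⊖ x zero)) ⟩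
      F (suc k) c ∎
      where
      open ≡-Reasoning
      c = b ⊖ suc j · x zero

    -- Expands every F⁺ into F plus a shifted F of one order lower; the shift by `x zero` commutes
    -- with the multiples of y. The second sum is one term shorter because F⁺ of order 0 has no
    -- shifted part.
    alternating-other : ∀ y j k b →
      alternating F⁺ y j (suc k) b ≡ alternating F y j (suc k) b + alternating F y j k (b ⊖ x zero)
    alternating-other y j zero    b = sym (ℚ.+-identityʳ _)
    alternating-other y j (suc k) b = begin
      F (suc k) c + F k (c ⊖ x zero) - alternating F⁺ y (suc j) (suc k) b
        ≡⟨ cong₂ (λ s t → F (suc k) c + s - t) (F-cong k (⊖-comm b _ _)) (alternating-other y (suc j) k b) ⟩
      F (suc k) c + F k (b ⊖ x zero ⊖ suc j · y) - (alternating F y (suc j) (suc k) b + alternating F y (suc j) k (b ⊖ x zero))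
        ≡⟨ solve 4 (λ p q r s → p :+ q :- (r :+ s) := p :- r :+ (q :- s)) refl (F (suc k) c) (F k (b ⊖ x zero ⊖ suc j · y))
             (alternating F y (suc j) (suc k) b) (alternating F y (suc j) k (b ⊖ x zero)) ⟩
      alternating F y j (suc (suc k)) b + alternating F y j (suc k) (b ⊖ x zero) ∎
      where
      open ≡-Reasoning
      c = b ⊖ suc j · y

  -- The power sums are expanded over the elements of D, which permits induction on D instead of k.
  -- The adjoined element's own sum telescopes to `F k b'`; the other elements give the hypothesis
  -- at orders `suc k` and `k`, and the telescoped term is exactly the copy of `F k b'` that turns
  -- the coefficient k into k + 1.
  newton : ∀ {f} → Congruent f → ∀ {n} (x : Fin n → Carrier) D k b →
    fromℕ k * elementary f x D k b ≡ sumIn D (λ i → alternating (elementary f x D) (x i) 0 k b)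
  newton {f} f-cong x D             zero    b = trans (ℚ.*-zeroˡ (elementary f x D 0 b)) (sym (sumIn-zero D))
  newton     f-cong x []            (suc k) b = ℚ.*-zeroʳ (fromℕ (suc k))
  newton     f-cong x (outside ∷ D) (suc k) b = trans (newton f-cong (x ∘ suc) D (suc k) b) (sym (ℚ.+-identityˡ _))
  newton {f} f-cong x (inside ∷ D)  (suc k) b = begin
    fromℕ (suc k) * (F (suc k) b + F k b')
      ≡⟨ ℚ.*-distribˡ-+ (fromℕ (suc k)) (F (suc k) b) (F k b') ⟩
    fromℕ (suc k) * F (suc k) b + fromℕ (suc k) * F k b'
      ≡⟨ cong (λ t → fromℕ (suc k) * F (suc k) b + t * F k b') (fromℕ-suc k) ⟩
    fromℕ (suc k) * F (suc k) b + (1ℚ + fromℕ k) * F k b'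
      ≡⟨ solve 3 (λ p k q → p :+ (con 1ℚ :+ k) :* q := q :+ (p :+ k :* q)) refl (fromℕ (suc k) * F (suc k) b) (fromℕ k) (F k b') ⟩
    F k b' + (fromℕ (suc k) * F (suc k) b + fromℕ k * F k b')
      ≡⟨ cong (F k b' ℚ.+_) (cong₂ _+_ (newton f-cong (x ∘ suc) D (suc k) b) (newton f-cong (x ∘ suc) D k b')) ⟩
    F k b' + (sumIn D (λ i → alternating F (x (suc i)) 0 (suc k) b) + sumIn D (λ i → alternating F (x (suc i)) 0 k b'))
      ≡⟨ cong₂ _+_ head (trans (sumIn-cong D (λ i → alternating-other f-cong x D (x (suc i)) 0 k b)) (sumIn-distrib-+ D _ _)) ⟨
    alternating F⁺ (x zero) 0 (suc k) b + sumIn D (λ i → alternating F⁺ (x (suc i)) 0 (suc k) b) ∎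
    where
    open ≡-Reasoning
    F⁺ = elementary f x (inside ∷ D)
    F  = elementary f (x ∘ suc) D
    b' = b ⊖ x zero
    head : alternating F⁺ (x zero) 0 (suc k) b ≡ F k b'
    head = trans (alternating-self f-cong x D 0 k b) (elementary-cong f-cong (x ∘ suc) D k (⊖-congˡ (identityʳ (x zero))))

-- Lengths of filtered lists, indicators, and reindexing of finite sums.

private variable
  p q : Level
  A B : Set p

length-filter-map : ∀ {P : Pred B p} {Q : Pred A q} (P? : Unary.Decidable P) (Q? : Unary.Decidable Q) (f : A → B) →
  (∀ x → P (f x) ⇔ Q x) → ∀ xs → length (filter P? (map f xs)) ≡ length (filter Q? xs)
length-filter-map P? Q? f P⇔Q []       = refl
length-filter-map P? Q? f P⇔Q (x ∷ xs) with does (P? (f x)) | does (Q? x) | does-⇔ (P⇔Q x) (P? (f x)) (Q? x)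
... | true  | _ | refl = cong suc (length-filter-map P? Q? f P⇔Q xs)
... | false | _ | refl = length-filter-map P? Q? f P⇔Q xs

length-filter-map-none : ∀ {P : Pred B p} (P? : Unary.Decidable P) (f : A → B) →
  (∀ x → ¬ P (f x)) → ∀ xs → length (filter P? (map f xs)) ≡ 0
length-filter-map-none P? f ¬P []       = refl
length-filter-map-none P? f ¬P (x ∷ xs) rewrite dec-false (P? (f x)) (¬P x) = length-filter-map-none P? f ¬P xs

indicator : Bool → ℚ
indicator t = if t then 1ℚ else 0ℚ

length-filter-[_] : ∀ {P : Pred A p} (P? : Unary.Decidable P) x → fromℕ (length (filter P? [ x ])) ≡ indicator (does (P? x))
length-filter-[_] P? x with does (P? x)
... | true  = refl
... | false = refl

sum-indicator-≟ : ∀ {n} (j : Fin n) → sum (λ i → indicator (does (i Fin.≟ j))) ≡ 1ℚ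
sum-indicator-≟ {suc n} zero    = cong (1ℚ ℚ.+_) (trans (sum-const n 0ℚ) (ℚ.*-zeroʳ (fromℕ n)))
sum-indicator-≟ {suc n} (suc j) = trans (ℚ.+-identityˡ _) (sum-indicator-≟ j)

injective⇒surjective : ∀ {n} {f : Fin n → Fin n} → Injective _≡_ _≡_ f → ∀ y → ∃[ x ] f x ≡ y
injective⇒surjective {suc n} {f} f-inj y with Fin.any? (λ x → f x Fin.≟ y)
... | yes hit  = hit
... | no  miss = contradiction (Fin.injective⇒≤ {f = λ x → punchOut (y≢f x)} (λ eq → f-inj (Fin.punchOut-injective (y≢f _) (y≢f _) eq))) ℕ.1+n≰n
  where
  y≢f : ∀ x → y ≢ f x
  y≢f x y≡fx = miss (x , sym y≡fx)

sum-injective : ∀ {n} (g : Fin n → ℚ) {f : Fin n → Fin n} → Injective _≡_ _≡_ f → sum (g ∘ f) ≡ sum g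
sum-injective g {f} f-inj = sym (sum-permute g (permutation f (proj₁ ∘ f-surj) (proj₂ ∘ f-surj)
  (λ x → f-inj (proj₂ (f-surj (f x))))))
  where f-surj = injective⇒surjective f-inj

-- Orders of elements, the exponent, and multiplication by integers coprime to it.

module Finite {a ℓ} (G : FiniteAbelianGroup a ℓ) where
  open FiniteAbelianGroup G using (abelianGroup; order; enumeration; index; element; order-nonZero; _≈?_; N; HasOrder; IsExponent)
  open AbelianGroup abelianGroup using (Carrier; _≈_; identityˡ; identityʳ; inverseˡ; assoc; comm; ∙-congˡ; ∙-congʳ; setoid; rawMonoid; commutativeMonoid; group)
    renaming (_∙_ to _⊕_; _-_ to _⊖_; _⁻¹ to neg; ε to 0#; refl to ≈-refl; sym to ≈-sym; trans to ≈-trans)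
  open RawMonoidDefs rawMonoid using () renaming (_×_ to _·_; sum to sumᴳ)
  open GroupProperties group using (∙-cancelˡ; ∙-cancelʳ; identityʳ-unique; identityˡ-unique; x∙y⁻¹≈ε⇒x≈y)
  open Mult commutativeMonoid using (×-congʳ; ×-congˡ; ×-homo-+; ×-assocˡ; ×-distrib-+)
  open Elementary abelianGroup
  module ≈-Reasoning = SetoidReasoning setoid

  element-index : ∀ y → element (index y) ≈ y
  element-index y = Inverse.strictlyInverseʳ enumeration y

  index-element : ∀ i → index (element i) ≡ i
  index-element i = Inverse.strictlyInverseˡ enumeration i

  index-cong : ∀ {x y} → x ≈ y → index x ≡ index y
  index-cong = Inverse.to-cong enumeration

  index-injective : ∀ {x y} → index x ≡ index y → x ≈ y
  index-injective {x} {y} eq = ≈-trans (≈-sym (element-index x)) (≈-trans (Inverse.from-cong enumeration eq) (element-index y))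

  element-injective : ∀ {i j} → element i ≈ element j → i ≡ j
  element-injective {i} {j} eq = trans (sym (index-element i)) (trans (index-cong eq) (index-element j))

  ·-zeroʳ : ∀ n → n · 0# ≈ 0#
  ·-zeroʳ zero    = ≈-refl
  ·-zeroʳ (suc n) = ≈-trans (identityˡ _) (·-zeroʳ n)

  multiple-zero : ∀ {y} j k → j · y ≈ 0# → (k ℕ.* j) · y ≈ 0#
  multiple-zero {y} j k jy≈0 = ≈-trans (≈-sym (×-assocˡ y k j)) (≈-trans (×-congʳ k jy≈0) (·-zeroʳ k))

  -- Two of the `order + 1` multiples 0 y, ..., `order` y coincide by the pigeonhole principle, and
  -- their difference is a period. The bound on m is what `exponent≤order` relies on.
  ∃period : ∀ y → ∃[ m ] 0 < m × m ℕ.≤ order × m · y ≈ 0#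
  ∃period y with i , j , i<j , eq ← Fin.pigeonhole (ℕ.n<1+n order) (λ (i : Fin (suc order)) → index (toℕ i · y)) =
    toℕ j ℕ.∸ toℕ i , ℕ.m<n⇒0<n∸m i<j , ℕ.≤-trans (ℕ.m∸n≤m (toℕ j) (toℕ i)) (ℕ.≤-pred (Fin.toℕ<n j)) ,
    identityʳ-unique (toℕ i · y) _ (≈-trans (≈-sym (×-homo-+ y (toℕ i) (toℕ j ℕ.∸ toℕ i)))
      (≈-trans (×-congˡ (ℕ.m+[n∸m]≡n (ℕ.<⇒≤ i<j))) (≈-sym (index-injective eq))))

  ∃order : ∀ y → ∃[ m ] HasOrder y m
  ∃order y with m , 0<m , _ , my≈0 ← ∃period y = <-rec (λ m → 0 < m → m · y ≈ 0# → ∃[ m ] HasOrder y m) step m 0<m my≈0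
    where
    step : ∀ m → (∀ {j} → j < m → 0 < j → j · y ≈ 0# → ∃[ m ] HasOrder y m) → 0 < m → m · y ≈ 0# → ∃[ m ] HasOrder y m
    step m smaller 0<m my≈0 with ℕ.anyUpTo? (λ j → (1 ℕ.≤? j) ×-dec ((j · y) ≈? 0#)) m
    ... | yes (j , j<m , 0<j , jy≈0) = smaller j<m 0<j jy≈0
    ... | no none = m , 0<m , my≈0 , λ j 0<j jy≈0 → ℕ.≮⇒≥ (λ j<m → none (j , j<m , 0<j , jy≈0))

  order∣ : ∀ {y m j} → HasOrder y m → j · y ≈ 0# → m ∣ j
  order∣ {y} {m} {j} (0<m , my≈0 , least) jy≈0 = m%n≡0⇒n∣m j m (ℕ.n<1⇒n≡0 (ℕ.≰⇒> (λ 0<r → ℕ.<⇒≱ (m%n<n j m) (least (j % m) 0<r ry≈0))))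
    where
    instance _ = ℕ.>-nonZero 0<m
    ry≈0 : (j % m) · y ≈ 0#
    ry≈0 = begin
      (j % m) · y                                ≈⟨ identityʳ _ ⟨
      (j % m) · y ⊕ 0#                           ≈⟨ ∙-congˡ (multiple-zero m (j ℕ./ m) my≈0) ⟨
      (j % m) · y ⊕ (j ℕ./ m ℕ.* m) · y          ≈⟨ ×-homo-+ y (j % m) (j ℕ./ m ℕ.* m) ⟨
      (j % m ℕ.+ j ℕ./ m ℕ.* m) · y              ≈⟨ ×-congˡ (m≡m%n+[m/n]*n j m) ⟨
      j · y                                      ≈⟨ jy≈0 ⟩
      0#                                         ∎
      where open ≈-Reasoning

  exponent≤order : ∀ {e} → IsExponent e → e ℕ.≤ order
  exponent≤order ((z , _ , _ , least) , _) with m , 0<m , m≤order , mz≈0 ← ∃period z = ℕ.≤-trans (least m 0<m mz≈0) m≤order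

  coprime-killed : ∀ {i j x} → Coprime i j → i · x ≈ 0# → j · x ≈ 0# → x ≈ 0#
  coprime-killed {i} {j} {x} i⊥j ix≈0 jx≈0 with coprime-Bézout i⊥j
  ... | Bézout.+- a b eq = ≈-trans (≈-sym (≈-trans (∙-congˡ (multiple-zero j b jx≈0)) (identityʳ x))) (≈-trans (×-congˡ eq) (multiple-zero i a ix≈0))
  ... | Bézout.-+ a b eq = ≈-trans (≈-sym (≈-trans (∙-congˡ (multiple-zero i a ix≈0)) (identityʳ x))) (≈-trans (×-congˡ eq) (multiple-zero j b jx≈0))

  -- If z has order e and i is prime to e, the order of z + x is a multiple of e, hence equals e by
  -- maximality, so that e x = 0.
  ·-kernel-trivial : ∀ {i e} → IsExponent e → Coprime i e → ∀ {x} → i · x ≈ 0# → x ≈ 0#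
  ·-kernel-trivial {i} {e} ((z , z-order@(_ , ez≈0 , _)) , maximal) i⊥e {x} ix≈0
    with m , y-order@(0<m , my≈0 , _) ← ∃order (z ⊕ x) = coprime-killed i⊥e ix≈0 ex≈0
    where
    open ≈-Reasoning
    -- The multiple i m kills x and z + x, hence also z. So e divides i m, and coprimality of i and
    -- e leaves e dividing m.
    imz≈0 : (i ℕ.* m) · z ≈ 0#
    imz≈0 = begin
      (i ℕ.* m) · z                          ≈⟨ identityʳ _ ⟨
      (i ℕ.* m) · z ⊕ 0#                     ≈⟨ ∙-congˡ (≈-trans (×-congˡ (ℕ.*-comm i m)) (multiple-zero i m ix≈0)) ⟨
      (i ℕ.* m) · z ⊕ (i ℕ.* m) · x          ≈⟨ ×-distrib-+ z x (i ℕ.* m) ⟨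
      (i ℕ.* m) · (z ⊕ x)                    ≈⟨ multiple-zero m i my≈0 ⟩
      0#                                     ∎
    m≡e : m ≡ e
    m≡e = ℕ.≤-antisym (maximal (z ⊕ x) m y-order)
      (∣⇒≤ {{ℕ.>-nonZero 0<m}} (coprime-divisor (coprime-sym i⊥e) (order∣ z-order imz≈0)))
    ex≈0 : e · x ≈ 0#
    ex≈0 = begin
      e · x                ≈⟨ identityˡ _ ⟨
      0# ⊕ e · x           ≈⟨ ∙-congʳ ez≈0 ⟨
      e · z ⊕ e · x        ≈⟨ ×-distrib-+ z x e ⟨
      e · (z ⊕ x)          ≈⟨ ×-congˡ m≡e ⟨
      m · (z ⊕ x)          ≈⟨ my≈0 ⟩
      0#                   ∎

  ·-injective : ∀ {i e} → IsExponent e → Coprime i e → ∀ {x y} → i · x ≈ i · y → x ≈ y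
  ·-injective {i} isExp i⊥e {x} {y} ix≈iy = x∙y⁻¹≈ε⇒x≈y x y (·-kernel-trivial isExp i⊥e
    (identityˡ-unique _ (i · y) (begin
      i · (x ⊖ y) ⊕ i · y      ≈⟨ ×-distrib-+ (x ⊖ y) y i ⟨
      i · ((x ⊖ y) ⊕ y)          ≈⟨ ×-congʳ i (≈-trans (assoc x (neg y) y) (≈-trans (∙-congˡ (inverseˡ y)) (identityʳ x))) ⟩
      i · x                    ≈⟨ ix≈iy ⟩
      i · y                    ∎)))
    where open ≈-Reasoning

  -- Totals over the group and their invariance under permutations.

  total : (Carrier → ℚ) → ℚ
  total h = sum (h ∘ element)

  total-injective : ∀ {h} → Congruent h → (φ : Carrier → Carrier) → (∀ {x y} → φ x ≈ φ y → x ≈ y) → total (h ∘ φ) ≡ total h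
  total-injective {h} h-cong φ φ-inj = trans
    (sum-cong-≗ (λ i → h-cong (≈-sym (element-index (φ (element i))))))
    (sum-injective (h ∘ element) (λ eq → element-injective (φ-inj (index-injective eq))))

  ⊖-injectiveˡ : ∀ {x y} t → x ⊖ t ≈ y ⊖ t → x ≈ y
  ⊖-injectiveˡ t = ∙-cancelʳ (neg t) _ _

  ⊖-injectiveʳ : ∀ b {x y} → b ⊖ x ≈ b ⊖ y → x ≈ y
  ⊖-injectiveʳ b {x} {y} eq = GroupProperties.⁻¹-injective group (∙-cancelˡ b _ _ eq)

  -- Each branch of the recursion is either unshifted or composed with a translation, which permutes
  -- the group.
  total-elementary : ∀ {f} → Congruent f → total f ≡ 0ℚ → ∀ {n} (x : Fin n → Carrier) D k → total (elementary f x D k) ≡ 0ℚ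
  total-elementary f-cong f-total x []            zero    = f-total
  total-elementary f-cong f-total x []            (suc k) = trans (sum-const order 0ℚ) (ℚ.*-zeroʳ (fromℕ order))
  total-elementary f-cong f-total x (outside ∷ D) k       = total-elementary f-cong f-total (x ∘ suc) D k
  total-elementary f-cong f-total x (inside ∷ D)  zero    = total-elementary f-cong f-total (x ∘ suc) D zero
  total-elementary {f} f-cong f-total x (inside ∷ D) (suc k) = trans
    (∑-distrib-+ (F (suc k) ∘ element) (λ i → F k (element i ⊖ x zero)))
    (cong₂ _+_ (total-elementary f-cong f-total (x ∘ suc) D (suc k))
      (trans (total-injective (elementary-cong f-cong (x ∘ suc) D k) (_⊖ x zero) (⊖-injectiveˡ (x zero)))
             (total-elementary f-cong f-total (x ∘ suc) D k)))
    where F = elementary f (x ∘ suc) D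

  δ : Carrier → ℚ
  δ b = indicator (does (b ≈? 0#))

  δ-cong : Congruent δ
  δ-cong {b} {c} b≈c = cong indicator (does-⇔ (mk⇔ (≈-trans (≈-sym b≈c)) (≈-trans b≈c)) (b ≈? 0#) (c ≈? 0#))

  total-δ : total δ ≡ 1ℚ
  total-δ = trans (sum-cong-≗ (λ i → cong indicator (does-⇔
      (mk⇔ (λ eq → trans (sym (index-element i)) (index-cong eq)) (λ eq → index-injective (trans (index-element i) eq)))
      (element i ≈? 0#) (i Fin.≟ index 0#))))
    (sum-indicator-≟ (index 0#))

  -- Subset counts as elementary symmetric functions of `δ`.

  module _ {n} (x : Fin n → Carrier) where
    -- Arbitrary families are allowed because removing the head of D leaves a tail of the
    -- enumeration, which no longer lists the whole group. For the family `element`, `familySum` and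
    -- `count` are `subsetSum` and `N` by computation.
    familySum : Subset n → Carrier
    familySum S = sumᴳ (λ i → if lookup S i then x i else 0#)

    Selected : Subset n → ℕ → Carrier → Subset n → Set ℓ
    Selected D k b S = S ⊆ D × ∣ S ∣ ≡ k × familySum S ≈ b

    selected? : ∀ D k b → Unary.Decidable (Selected D k b)
    selected? D k b S = (S ⊆? D) ×-dec (∣ S ∣ ℕ.≟ k) ×-dec (familySum S ≈? b)

    count : Subset n → ℕ → Carrier → ℕ
    count D k b = length (filter (selected? D k b) (allSubsets n))

  module _ {n} (x : Fin (suc n) → Carrier) where
    selected-outside : ∀ {s D k b} S → Selected x (s ∷ D) k b (outside ∷ S) ⇔ Selected (x ∘ suc) D k b S
    selected-outside S = mk⇔
      (λ (S⊆D , size , eq) → drop-∷-⊆ S⊆D , size , ≈-trans (≈-sym (identityˡ _)) eq)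
      (λ (S⊆D , size , eq) → out⊆ S⊆D , size , ≈-trans (identityˡ _) eq)

    selected-inside : ∀ {D k b} S → Selected x (inside ∷ D) (suc k) b (inside ∷ S) ⇔ Selected (x ∘ suc) D k (b ⊖ x zero) S
    selected-inside {b = b} S = mk⇔
      (λ (S⊆D , size , eq) → drop-∷-⊆ S⊆D , ℕ.suc-injective size ,
         ∙-cancelˡ (x zero) _ _ (≈-trans eq (≈-sym x+[b-x]≈b)))
      (λ (S⊆D , size , eq) → in⊆in S⊆D , cong suc size , ≈-trans (∙-congˡ eq) x+[b-x]≈b)
      where
      x+[b-x]≈b : x zero ⊕ (b ⊖ x zero) ≈ b
      x+[b-x]≈b = ≈-trans (comm _ _) (≈-trans (assoc b _ _) (≈-trans (∙-congˡ (inverseˡ (x zero))) (identityʳ b)))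

    count-split : ∀ D k b → count x D k b ≡
      length (filter (selected? x D k b) (map (outside ∷_) (allSubsets n))) ℕ.+
      length (filter (selected? x D k b) (map (inside ∷_) (allSubsets n)))
    count-split D k b = trans
      (cong length (filter-++ (selected? x D k b) (map (outside ∷_) (allSubsets n)) (map (inside ∷_) (allSubsets n))))
      (length-++ (filter (selected? x D k b) (map (outside ∷_) (allSubsets n))))

    -- The side s is left open to serve both situations in which the head cannot be chosen: it lies
    -- outside D, or k is 0.
    count-outside : ∀ s D k b → (∀ S → ¬ Selected x (s ∷ D) k b (inside ∷ S)) → count x (s ∷ D) k b ≡ count (x ∘ suc) D k b
    count-outside s D k b none = trans (count-split (s ∷ D) k b) (trans
      (cong₂ ℕ._+_
        (length-filter-map (selected? x (s ∷ D) k b) (selected? (x ∘ suc) D k b) (outside ∷_) selected-outside (allSubsets n))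
        (length-filter-map-none (selected? x (s ∷ D) k b) (inside ∷_) none (allSubsets n)))
      (ℕ.+-identityʳ _))

    count-inside : ∀ D k b → count x (inside ∷ D) (suc k) b ≡ count (x ∘ suc) D (suc k) b ℕ.+ count (x ∘ suc) D k (b ⊖ x zero)
    count-inside D k b = trans (count-split (inside ∷ D) (suc k) b)
      (cong₂ ℕ._+_
        (length-filter-map (selected? x (inside ∷ D) (suc k) b) (selected? (x ∘ suc) D (suc k) b) (outside ∷_) selected-outside (allSubsets n))
        (length-filter-map (selected? x (inside ∷ D) (suc k) b) (selected? (x ∘ suc) D k (b ⊖ x zero)) (inside ∷_) selected-inside (allSubsets n)))

  count-elementary : ∀ {n} (x : Fin n → Carrier) D k b → fromℕ (count x D k b) ≡ elementary δ x D k b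
  count-elementary x [] zero b = trans (length-filter-[_] (selected? x [] zero b) [])
    (cong indicator (does-⇔ selected⇔ (selected? x [] zero b []) (b ≈? 0#)))
    where
    selected⇔ : Selected x [] zero b [] ⇔ (b ≈ 0#)
    selected⇔ = mk⇔ (λ (_ , _ , eq) → ≈-sym eq) (λ eq → (λ {_} i∈[] → i∈[]) , refl , ≈-sym eq)
  count-elementary x [] (suc k) b = trans (length-filter-[_] (selected? x [] (suc k) b) [])
    (cong indicator (dec-false (selected? x [] (suc k) b []) (λ ())))
  count-elementary x (outside ∷ D) k b = trans
    (cong fromℕ (count-outside x outside D k b (λ S (S⊆D , _) → contradiction (S⊆D here) λ ())))
    (count-elementary (x ∘ suc) D k b)
  count-elementary x (inside ∷ D) zero b = trans
    (cong fromℕ (count-outside x inside D zero b (λ S ())))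
    (count-elementary (x ∘ suc) D zero b)
  count-elementary x (inside ∷ D) (suc k) b = trans (cong fromℕ (count-inside x D k b))
    (trans (fromℕ-+ (count (x ∘ suc) D (suc k) b) _)
      (cong₂ _+_ (count-elementary (x ∘ suc) D (suc k) b) (count-elementary (x ∘ suc) D k (b ⊖ x zero))))

  -- The estimate: weights, slack, and strong induction on k.

  module Bound (D : Subset order) (c : ℕ) (∣D∣+c≡order : ∣ D ∣ ℕ.+ c ≡ order) (c≤∣D∣ : c ℕ.≤ ∣ D ∣)
               {e : ℕ} (exponent : IsExponent e) where

    private
      instance
        e-nonZero : NonZero e
        e-nonZero = ℕ.>-nonZero (proj₁ (proj₂ (proj₁ exponent)))

      js = negMöbiusIndices e
      S  = negMöbiusSum e
      M  = fromℕ order - fromℕ 2 * fromℕ c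

      z : ℚ
      z = fromℕ c + M * S

      order≡ : fromℕ order ≡ fromℕ ∣ D ∣ + fromℕ c
      order≡ = trans (cong fromℕ (sym ∣D∣+c≡order)) (fromℕ-+ ∣ D ∣ c)

      ∣D∣≡c+M : fromℕ ∣ D ∣ ≡ fromℕ c + M
      ∣D∣≡c+M = trans (solve 2 (λ d c → d := c :+ (d :+ c :- con (fromℕ 2) :* c)) refl (fromℕ ∣ D ∣) (fromℕ c))
        (cong (λ t → fromℕ c + (t - fromℕ 2 * fromℕ c)) (sym order≡))

      M-nonNeg : 0ℚ ≤ M
      M-nonNeg = subst (0ℚ ≤_) eq (fromℕ-nonNeg (∣ D ∣ ℕ.∸ c))
        where
        eq : fromℕ (∣ D ∣ ℕ.∸ c) ≡ M
        eq = trans (solve 2 (λ r c → r := r :+ c :+ c :- con (fromℕ 2) :* c) refl (fromℕ (∣ D ∣ ℕ.∸ c)) (fromℕ c))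
          (cong (λ t → t - fromℕ 2 * fromℕ c) (trans (cong (_+ fromℕ c)
            (trans (sym (fromℕ-+ (∣ D ∣ ℕ.∸ c) c)) (cong fromℕ (ℕ.m∸n+n≡m c≤∣D∣)))) (sym order≡)))

      S-nonNeg : 0ℚ ≤ S
      S-nonNeg = sumOver-nonNeg (λ j → 1/n-nonNeg (suc j)) js

      z-nonNeg : 0ℚ ≤ z
      z-nonNeg = +-nonNeg (fromℕ-nonNeg c) (*-nonNeg M-nonNeg S-nonNeg)

      -- If c ≥ 1, the summand c suffices. If c = 0, then z is `order` times S, and a prime p
      -- dividing e has p ≤ e ≤ `order` and contributes 1/p to S.
      1≤z : e ≢ 1 → 1ℚ ≤ z
      1≤z e≢1 = lower c refl
        where
        open ℚ.≤-Reasoning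
        lower : ∀ c' → c' ≡ c → 1ℚ ≤ z
        lower (suc c') refl = begin
          1ℚ                          ≤⟨ fromℕ-mono-≤ (ℕ.s≤s (ℕ.z≤n {c'})) ⟩
          fromℕ c                     ≡⟨ ℚ.+-identityʳ (fromℕ c) ⟨
          fromℕ c + 0ℚ                ≤⟨ ℚ.+-monoʳ-≤ (fromℕ c) (*-nonNeg M-nonNeg S-nonNeg) ⟩
          z                           ∎
        lower zero refl with j , p-prime , p∣e ← ∃prime∣ e e≢1 = begin
          1ℚ                                  ≡⟨ fromℕ*1/n≡1 (suc j) ⟨
          fromℕ (suc j) * (+ 1 / suc j)       ≤⟨ *-mono-≤ (fromℕ-nonNeg (suc j)) S-nonNeg
                                                   (fromℕ-mono-≤ (ℕ.≤-trans (∣⇒≤ p∣e) (exponent≤order exponent)))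
                                                   (∈⇒≤sumOver (λ j → 1/n-nonNeg (suc j)) (prime∣⇒∈negMöbiusIndices p-prime p∣e)) ⟩
          fromℕ order * S                     ≡⟨ solve 2 (λ o s → o :* s := con 0ℚ :+ (o :- con (fromℕ 2) :* con 0ℚ) :* s) refl (fromℕ order) S ⟩
          z                                   ∎

      Y = multichoose z

      Y-nonNeg : ∀ k → 0ℚ ≤ Y k
      Y-nonNeg = multichoose-nonNeg z-nonNeg

      -- Since every i not coprime to e is a multiple of a prime divisor of e, weight i bounds
      -- c for i coprime to e and ∣ D ∣ = c + M for all other i.
      weight : ℕ → ℚ
      weight i = fromℕ c + M * divisorCount js i

      -- This is `z - weight i`. It can be negative at single i; only its partial sums are known to
      -- be nonnegative.
      slack : ℕ → ℚ
      slack i = M * (S - divisorCount js i)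

      partialSum-slack : ∀ j → partialSum slack j ≡ M * (fromℕ j * S - partialSum (divisorCount js) j)
      partialSum-slack zero    = solve 2 (λ m s → con 0ℚ := m :* (con 0ℚ :* s :- con 0ℚ)) refl M S
      partialSum-slack (suc j) = trans (cong (_+ slack (suc j)) (partialSum-slack j)) (trans
        (solve 5 (λ m j s w v → m :* (j :* s :- w) :+ m :* (s :- v) := m :* ((con 1ℚ :+ j) :* s :- (w :+ v))) refl
          M (fromℕ j) S (partialSum (divisorCount js) j) (divisorCount js (suc j)))
        (cong (λ t → M * (t * S - partialSum (divisorCount js) (suc j))) (sym (fromℕ-suc j))))

      partialSum-slack-nonNeg : ∀ j → 0ℚ ≤ partialSum slack j
      partialSum-slack-nonNeg j = subst (0ℚ ≤_) (sym (partialSum-slack j))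
        (*-nonNeg M-nonNeg (p≤q⇒0≤q-p (partialSum-divisorCount-≤ js j)))

      convolution-slack-nonNeg : ∀ k → 0ℚ ≤ convolution slack Y 0 k
      convolution-slack-nonNeg k with e ℕ.≟ 1
      ... | no  e≢1  = convolution-nonNeg slack Y partialSum-slack-nonNeg Y-nonNeg (multichoose-mono (1≤z e≢1)) k
      -- Here z = 0 and Y is not monotone, so Abel summation does not apply; but
      -- `negMöbiusIndices 1` is empty and every slack is 0.
      ... | yes refl = ℚ.≤-reflexive (sym (vanishes 0 k))
        where
        vanishes : ∀ j k → convolution slack Y j k ≡ 0ℚ
        vanishes j zero    = refl
        vanishes j (suc k) = trans (cong (slack (suc j) * Y k ℚ.+_) (vanishes (suc j) k))
          (solve 2 (λ m y → m :* (con 0ℚ :- con 0ℚ) :* y :+ con 0ℚ := con 0ℚ) refl M (Y k))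

      convolution-weight-≤ : ∀ k → convolution weight Y 0 k ≤ fromℕ k * Y k
      convolution-weight-≤ k = begin
        convolution weight Y 0 k                                 ≡⟨ ℚ.+-identityʳ (convolution weight Y 0 k) ⟨
        convolution weight Y 0 k + 0ℚ                            ≤⟨ ℚ.+-monoʳ-≤ (convolution weight Y 0 k) (convolution-slack-nonNeg k) ⟩
        convolution weight Y 0 k + convolution slack Y 0 k       ≡⟨ convolution-distrib-+ {weight} {slack} {λ _ → z} Y split 0 k ⟨
        convolution (λ _ → z) Y 0 k                              ≡⟨ convolution-multichoose z 0 k ⟩
        fromℕ k * Y k                                            ∎
        where
        open ℚ.≤-Reasoning
        split : ∀ i → z ≡ weight i + slack i
        split i = solve 4 (λ c m s w → c :+ m :* s := c :+ m :* w :+ m :* (s :- w)) refl (fromℕ c) M S (divisorCount js i)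

      1/order = + 1 / order

      f : Carrier → ℚ
      f b = δ b - 1/order

      f-cong : Congruent f
      f-cong b≈c = cong (_- 1/order) (δ-cong b≈c)

      total-f : total f ≡ 0ℚ
      total-f = begin
        total f                                                   ≡⟨ ∑-distrib-+ (δ ∘ element) (λ _ → - 1/order) ⟩
        total δ + sum {order} (λ _ → - 1/order)                   ≡⟨ cong₂ _+_ total-δ (sum-const order (- 1/order)) ⟩
        1ℚ + fromℕ order * (- 1/order)                            ≡⟨ solve 2 (λ o r → con 1ℚ :+ o :* (:- r) := con 1ℚ :- o :* r) refl (fromℕ order) 1/order ⟩
        1ℚ - fromℕ order * 1/order                                ≡⟨ cong (λ t → 1ℚ - t) (fromℕ*1/n≡1 order) ⟩
        0ℚ                                                        ∎
        where open ≡-Reasoning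

      ∣f∣≤1 : ∀ b → ℚ.∣ f b ∣ ≤ 1ℚ
      ∣f∣≤1 b with does (b ≈? 0#)
      ... | true  = begin
        ℚ.∣ 1ℚ - 1/order ∣         ≡⟨ ℚ.0≤p⇒∣p∣≡p (p≤q⇒0≤q-p (1/n≤1 order)) ⟩
        1ℚ - 1/order               ≤⟨ ℚ.+-monoʳ-≤ 1ℚ (ℚ.neg-antimono-≤ (1/n-nonNeg order)) ⟩
        1ℚ - 0ℚ                    ≡⟨⟩
        1ℚ                         ∎
        where open ℚ.≤-Reasoning
      ... | false = begin
        ℚ.∣ 0ℚ - 1/order ∣         ≡⟨ cong ℚ.∣_∣ (ℚ.+-identityˡ (- 1/order)) ⟩
        ℚ.∣ - 1/order ∣            ≡⟨ ℚ.∣-p∣≡∣p∣ 1/order ⟩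
        ℚ.∣ 1/order ∣              ≡⟨ ℚ.0≤p⇒∣p∣≡p (1/n-nonNeg order) ⟩
        1/order                    ≤⟨ 1/n≤1 order ⟩
        1ℚ                         ∎
        where open ℚ.≤-Reasoning

      g : ℕ → Carrier → ℚ
      g = elementary f element D

      g-cong : ∀ k → Congruent (g k)
      g-cong = elementary-cong f-cong element D

      ∣∁D∣≡c : ∣ ∁ D ∣ ≡ c
      ∣∁D∣≡c = trans (∣∁p∣≡n∸∣p∣ D) (trans (cong (ℕ._∸ ∣ D ∣) (sym ∣D∣+c≡order)) (ℕ.m+n∸m≡n ∣ D ∣ c))

      ∣sumIn∣≤weight : ∀ k → (∀ b → ℚ.∣ g k b ∣ ≤ Y k) → ∀ b s → ℚ.∣ sumIn D (λ i → g k (b ⊖ s · element i)) ∣ ≤ weight s * Y k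
      ∣sumIn∣≤weight k ∣g∣≤Y b s with coprime? s e
      ... | yes s⊥e = begin
        ℚ.∣ sumIn D h ∣                ≡⟨ cong ℚ.∣_∣ sumIn≡ ⟩
        ℚ.∣ - sumIn (∁ D) h ∣          ≡⟨ ℚ.∣-p∣≡∣p∣ (sumIn (∁ D) h) ⟩
        ℚ.∣ sumIn (∁ D) h ∣            ≤⟨ ∣sumIn∣≤ (∁ D) h (λ i → ∣g∣≤Y (b ⊖ s · element i)) ⟩
        fromℕ (∣ ∁ D ∣) * Y k          ≡⟨ cong (λ t → fromℕ t * Y k) ∣∁D∣≡c ⟩
        fromℕ c * Y k                  ≤⟨ *-monoʳ (Y-nonNeg k) c≤weight ⟩
        weight s * Y k                 ∎
        where
        open ℚ.≤-Reasoning
        h = λ i → g k (b ⊖ s · element i)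
        sum≡0 : sum h ≡ 0ℚ
        sum≡0 = trans
          (total-injective (g-cong k) (λ y → b ⊖ s · y) (λ eq → ·-injective exponent s⊥e (⊖-injectiveʳ b eq)))
          (total-elementary f-cong total-f element D k)
        sumIn≡ : sumIn D h ≡ - sumIn (∁ D) h
        sumIn≡ = trans (solve 2 (λ p q → p := p :+ q :- q) refl (sumIn D h) (sumIn (∁ D) h))
          (trans (cong (_- sumIn (∁ D) h) (trans (sumIn+sumIn-∁ D h) sum≡0)) (ℚ.+-identityˡ _))
        c≤weight : fromℕ c ≤ weight s
        c≤weight = subst (_≤ weight s) (ℚ.+-identityʳ (fromℕ c))
          (ℚ.+-monoʳ-≤ (fromℕ c) (*-nonNeg M-nonNeg (sumOver-nonNeg (isMultiple-nonNeg s) js)))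
      ... | no ¬s⊥e = begin
        ℚ.∣ sumIn D h ∣                ≤⟨ ∣sumIn∣≤ D h (λ i → ∣g∣≤Y (b ⊖ s · element i)) ⟩
        fromℕ (∣ D ∣) * Y k            ≡⟨ cong (_* Y k) ∣D∣≡c+M ⟩
        (fromℕ c + M) * Y k            ≡⟨ cong (λ t → (fromℕ c + t) * Y k) (ℚ.*-identityʳ M) ⟨
        (fromℕ c + M * 1ℚ) * Y k       ≤⟨ *-monoʳ (Y-nonNeg k) (ℚ.+-monoʳ-≤ (fromℕ c) (*-monoˡ M-nonNeg (divisorCount-¬coprime ¬s⊥e))) ⟩
        weight s * Y k                 ∎
        where
        open ℚ.≤-Reasoning
        h = λ i → g k (b ⊖ s · element i)

      -- The triangle inequality gives up the signs of Newton's identities: cancellation is used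
      -- only within the sum over D for one fixed multiple, never between different ones.
      ∣alternating∣≤ : ∀ j k → (∀ {i} → i < k → ∀ b → ℚ.∣ g i b ∣ ≤ Y i) → ∀ b →
        ℚ.∣ sumIn D (λ i → alternating g (element i) j k b) ∣ ≤ convolution weight Y j k
      ∣alternating∣≤ j zero    bounds b = ℚ.≤-reflexive (cong ℚ.∣_∣ (sumIn-zero D))
      ∣alternating∣≤ j (suc k) bounds b = begin
        ℚ.∣ sumIn D (λ i → h i - r i) ∣            ≡⟨ cong ℚ.∣_∣ (sumIn-distrib-- D h r) ⟩
        ℚ.∣ sumIn D h - sumIn D r ∣                ≤⟨ ℚ.∣p-q∣≤∣p∣+∣q∣ (sumIn D h) (sumIn D r) ⟩
        ℚ.∣ sumIn D h ∣ + ℚ.∣ sumIn D r ∣          ≤⟨ ℚ.+-mono-≤ (∣sumIn∣≤weight k (bounds (ℕ.n<1+n k)) b (suc j))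
                                                       (∣alternating∣≤ (suc j) k (λ i<k → bounds (ℕ.m<n⇒m<1+n i<k)) b) ⟩
        convolution weight Y j (suc k)             ∎
        where
        open ℚ.≤-Reasoning
        h = λ i → g k (b ⊖ suc j · element i)
        r = λ i → alternating g (element i) (suc j) k b

    ∣elementary∣≤multichoose : ∀ k b → ℚ.∣ g k b ∣ ≤ multichoose z k
    ∣elementary∣≤multichoose = <-rec (λ k → ∀ b → ℚ.∣ g k b ∣ ≤ Y k) step
      where
      open ℚ.≤-Reasoning
      step : ∀ k → (∀ {i} → i < k → ∀ b → ℚ.∣ g i b ∣ ≤ Y i) → ∀ b → ℚ.∣ g k b ∣ ≤ Y k
      -- `Y 0` reduces to 1, so the start of the induction is the bound on f.
      step zero    bounds b = subst (λ t → ℚ.∣ t ∣ ≤ 1ℚ) (sym (elementary-zero f element D b)) (∣f∣≤1 b)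
      step (suc k) bounds b = *-cancel-≤-suc k (begin
        fromℕ (suc k) * ℚ.∣ g (suc k) b ∣                           ≡⟨ cong (_* ℚ.∣ g (suc k) b ∣) (ℚ.0≤p⇒∣p∣≡p (fromℕ-nonNeg (suc k))) ⟨
        ℚ.∣ fromℕ (suc k) ∣ * ℚ.∣ g (suc k) b ∣                     ≡⟨ ℚ.∣p*q∣≡∣p∣*∣q∣ (fromℕ (suc k)) (g (suc k) b) ⟨
        ℚ.∣ fromℕ (suc k) * g (suc k) b ∣                           ≡⟨ cong ℚ.∣_∣ (newton f-cong element D (suc k) b) ⟩
        ℚ.∣ sumIn D (λ i → alternating g (element i) 0 (suc k) b) ∣ ≤⟨ ∣alternating∣≤ 0 (suc k) bounds b ⟩
        convolution weight Y 0 (suc k)                              ≤⟨ convolution-weight-≤ (suc k) ⟩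
        fromℕ (suc k) * Y (suc k)                                   ∎)

    N-main≡elementary : ∀ k b → fromℕ (N D k b) - 1/order * binom (fromℕ order - fromℕ c) k ≡ g k b
    N-main≡elementary k b = begin
      fromℕ (N D k b) - 1/order * binom (fromℕ order - fromℕ c) k
        ≡⟨ cong₂ (λ s t → s - 1/order * binom t k) (count-elementary element D k b) order-c ⟩
      elementary δ element D k b - 1/order * binom (fromℕ (∣ D ∣)) k
        -- The mean term is itself an elementary symmetric function, that of the constant `1/order`,
        -- so linearity can merge it with the count.
        ≡⟨ cong (λ t → elementary δ element D k b - t) (elementary-const 1/order element D k b) ⟨
      elementary δ element D k b - elementary (λ _ → 1/order) element D k b
        ≡⟨ elementary-distrib-- δ (λ _ → 1/order) element D k b ⟨
      g k b ∎
      where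
      open ≡-Reasoning
      order-c : fromℕ order - fromℕ c ≡ fromℕ ∣ D ∣
      order-c = trans (cong (_- fromℕ c) order≡) (solve 2 (λ d c → d :+ c :- c := d) refl (fromℕ ∣ D ∣) (fromℕ c))

    ∣N-main∣≤multichoose : ∀ k b →
      ℚ.∣ fromℕ (N D k b) - 1/order * binom (fromℕ order - fromℕ c) k ∣ ≤ multichoose z k
    ∣N-main∣≤multichoose k b =
      subst (λ t → ℚ.∣ t ∣ ≤ multichoose z k) (sym (N-main≡elementary k b)) (∣elementary∣≤multichoose k b)

theorem1p1 : ∀ {a ℓ} (G : FiniteAbelianGroup a ℓ) →
    let open FiniteAbelianGroup G in
    (D : Subset order) (c : ℕ) → ∣ D ∣ ℕ.+ c ≡ order → c ℕ.≤ ∣ D ∣ →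
    (b : Carrier) (k : ℕ) → k ℕ.≤ ∣ D ∣ →
    (e : ℕ) → IsExponent e →
    ℚ.∣ fromℕ (N D k b) - (+ 1 / order) * binom (fromℕ order - fromℕ c) k ∣
    ≤ binom (fromℕ c + (fromℕ order - fromℕ 2 * fromℕ c) * negMöbiusSum e + fromℕ k - 1ℚ) k
theorem1p1 G D c ∣D∣+c≡order c≤∣D∣ b k k≤∣D∣ e exponent =
  Finite.Bound.∣N-main∣≤multichoose G D c ∣D∣+c≡order c≤∣D∣ exponent k b
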